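{- Let $d\ge 2$ be a fixed integer and let the prime power $q$ tend to infinity. The number of general position sets in $\mathbb{F}_q^d$ is at most $2^{q+q^{\frac{2d}{2d+1}+o(1)}}$.
   Context: $\mathbb{F}_q$ is the finite field with $q$ elements. A hyperplane in $\mathbb{F}_q^d$ is a $(d-1)$-dimensional affine subspace; a point set $P\subset\mathbb{F}_q^d$ is in general position if no $d+1$ points of $P$ lie in a common hyperplane. The $o(1)$ term is with respect to $q\to\infty$. -}

module Defs where

open import Level using (0ℓ)
open import Data.Nat using (ℕ; zero; suc; _+_; _*_; _^_; _≤_)
open import Data.Nat.Primality using (Prime)
open import Data.Fin using (Fin)
open import Data.Vec using (Vec; []; _∷_; lookup)
open import Data.Bool using (Bool; true)
open import Data.Product using (Σ; ∃; ∃-syntax; _×_)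
open import Relation.Binary.PropositionalEquality using (_≡_; _≢_)
open import Relation.Nullary using (¬_)
open import Function.Definitions using (Injective)
open import Algebra.Structures using (IsCommutativeRing)

IsPrimePower : ℕ → Set
IsPrimePower q = ∃[ p ] ∃[ k ] (Prime p × 1 ≤ k × q ≡ p ^ k)

-- A finite field with exactly q elements, with carrier Fin q
-- (every field with q elements is isomorphic to one of this form).
record FiniteField (q : ℕ) : Set where
  field
    _+ᶠ_ _*ᶠ_ : Fin q → Fin q → Fin q
    -ᶠ_       : Fin q → Fin q
    0ᶠ 1ᶠ     : Fin q
    isCommutativeRing : IsCommutativeRing _≡_ _+ᶠ_ _*ᶠ_ -ᶠ_ 0ᶠ 1ᶠ
    0≢1       : 0ᶠ ≢ 1ᶠ
    inverse   : ∀ x → x ≢ 0ᶠ → ∃[ y ] (x *ᶠ y ≡ 1ᶠ)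

module _ {q : ℕ} (F : FiniteField q) where
  open FiniteField F

  Point : ℕ → Set
  Point d = Vec (Fin q) d

  dot : ∀ {d} → Vec (Fin q) d → Vec (Fin q) d → Fin q
  dot []       []       = 0ᶠ
  dot (a ∷ as) (x ∷ xs) = (a *ᶠ x) +ᶠ dot as xs

  NonZeroVec : ∀ {d} → Vec (Fin q) d → Set
  NonZeroVec {d} a = ∃[ j ] (lookup a j ≢ 0ᶠ)

  OnCommonHyperplane : ∀ {d} {n} → (Fin n → Point d) → Set
  OnCommonHyperplane {d} f =
    ∃[ a ] ∃[ c ] (NonZeroVec a × (∀ i → dot a (f i) ≡ c))

  GeneralPosition : ∀ d → (Point d → Bool) → Set
  GeneralPosition d P =
    (f : Fin (suc d) → Point d) → Injective _≡_ _≡_ f →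
    (∀ i → P (f i) ≡ true) → ¬ OnCommonHyperplane f

Differ : ∀ {A : Set} → (A → Bool) → (A → Bool) → Set
Differ P Q = ∃[ x ] (P x ≢ Q x)

{-# OPTIONS --safe #-}

-- Let P be in general position and let S be its first (d - 1) t elements in some enumeration of
-- the space. Cut S into d - 1 blocks of size t. Every transversal T of the blocks lies on a pencil
-- of q + 1 hyperplanes, and each member of the pencil contains at most one point of P \ S. So P \ S
-- is independent in the graph joining two points that lie in a common member of one of the
-- pencils. By Cauchy–Schwarz each pencil gives many such pairs in a set U with |U| > q + 1,
-- whereas a given pair is obtained from only a fraction O(1/t) of the transversals; so some vertex
-- of U has degree at least (|U| - (q + 1)) / K with K ≈ d² q / t. Branching on such a vertex shows
-- that the graph has at most 2^(q+1) (q^d + 1)^h independent sets, where h ≈ K d log q. There are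
-- at most (q^d + 1)^((d-1)t) choices of S, and t ≈ √q gives the bound 2^(q + q^(1/2 + o(1))),
-- which is stronger than required.

module Submission where

open import Defs
open import Level using (0ℓ)
open import Algebra.Bundles using (CommutativeRing)
import Algebra.Properties.Ring
import Algebra.Solver.Ring.NaturalCoefficients.Default
open import Data.Bool as Bool using (Bool; true; false; if_then_else_)
open import Data.Fin as Fin using (Fin; zero; suc; finToFun; funToFin)
import Data.Fin.Properties as Fin
open import Data.List as List using (List; []; _∷_; map; length; filter; take; drop; cartesianProductWith; allFin; _++_)
open import Data.List.Membership.Propositional using (_∈_; find; lose)
open import Data.List.Membership.Propositional.Properties
  using (∈-filter⁺; ∈-filter⁻; ∈-cartesianProductWith⁻; ∈-cartesianProductWith⁺; ∈-allFin; ∈-lookup)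
open import Data.List.Properties
  using (map-++; map-∘; map-cong; map-tabulate; length-tabulate; length-take; length-drop; length-map; length-++; filter-notAll)
open import Data.List.Relation.Unary.All as All using (All; []; _∷_)
import Data.List.Relation.Unary.All.Properties as All
open import Data.List.Relation.Unary.AllPairs as AllPairs using (AllPairs; []; _∷_)
import Data.List.Relation.Unary.AllPairs.Properties as AllPairs
open import Data.List.Relation.Unary.Any as Any using (Any; here; there)
open import Data.List.Relation.Unary.Unique.Propositional using (Unique)
import Data.List.Relation.Unary.Unique.Propositional.Properties as Unique
open import Data.Nat
open import Data.Nat.ListAction using (sum)
open import Data.Nat.ListAction.Properties using (sum-++)
open import Data.Nat.Properties
open import Data.Nat.Solver using (module +-*-Solver)
open import Data.Product using (_×_; _,_; ∃-syntax; proj₁; proj₂)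
open import Data.Sum using ([_,_]′)
open import Data.Unit using (⊤; tt)
open import Data.Vec as Vec using (Vec; []; _∷_; lookup; replicate; zipWith; tabulate)
import Data.Vec.Properties as Vec
open import Data.Vec.Relation.Unary.All as VAll using ([]; _∷_)
import Data.Vec.Relation.Unary.All.Properties as VAll
open import Data.Vec.Relation.Unary.AllPairs using ([]; _∷_)
import Data.Vec.Relation.Unary.Unique.Propositional as VUnique
import Data.Vec.Relation.Unary.Unique.Propositional.Properties as VUnique
open import Function using (_∘_)
open import Relation.Binary using (DecidableEquality)
open import Relation.Binary.PropositionalEquality
open import Relation.Nullary using (¬_; yes; no; contradiction; Dec; ¬?; does)
open import Relation.Unary using (Pred; Decidable)

-- Sums over lists

private variable A B : Set

∑ : List A → (A → ℕ) → ℕ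
∑ xs f = sum (map f xs)

⟦_⟧ : {P : Set} → Dec P → ℕ
⟦ P? ⟧ = if does P? then 1 else 0

⟦⟧-yes : {P : Set} (P? : Dec P) → P → ⟦ P? ⟧ ≡ 1
⟦⟧-yes (yes _) _ = refl
⟦⟧-yes (no ¬p) p = contradiction p ¬p

⟦⟧-no : {P : Set} (P? : Dec P) → ¬ P → ⟦ P? ⟧ ≡ 0
⟦⟧-no (yes p) ¬p = contradiction p ¬p
⟦⟧-no (no _)  _  = refl

⟦⟧≤1 : {P : Set} (P? : Dec P) → ⟦ P? ⟧ ≤ 1
⟦⟧≤1 (yes _) = ≤-refl
⟦⟧≤1 (no _)  = z≤n

∑-mono : (xs : List A) {f g : A → ℕ} → (∀ {x} → x ∈ xs → f x ≤ g x) → ∑ xs f ≤ ∑ xs g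
∑-mono []       f≤g = z≤n
∑-mono (x ∷ xs) f≤g = +-mono-≤ (f≤g (here refl)) (∑-mono xs (f≤g ∘ there))

∑-cong : (xs : List A) {f g : A → ℕ} → (∀ x → f x ≡ g x) → ∑ xs f ≡ ∑ xs g
∑-cong xs f≗g = cong sum (map-cong f≗g xs)

∑-const : (xs : List A) (c : ℕ) → ∑ xs (λ _ → c) ≡ length xs * c
∑-const []       c = refl
∑-const (_ ∷ xs) c = cong (c +_) (∑-const xs c)

∑-+ : (xs : List A) (f g : A → ℕ) → ∑ xs (λ x → f x + g x) ≡ ∑ xs f + ∑ xs g
∑-+ []       f g = refl
∑-+ (x ∷ xs) f g rewrite ∑-+ xs f g =
  solve 4 (λ a b c d → (a :+ b) :+ (c :+ d) := (a :+ c) :+ (b :+ d)) refl (f x) (g x) (∑ xs f) (∑ xs g)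
  where open +-*-Solver

∑-*ˡ : (xs : List A) (c : ℕ) (f : A → ℕ) → ∑ xs (λ x → c * f x) ≡ c * ∑ xs f
∑-*ˡ []       c f = sym (*-zeroʳ c)
∑-*ˡ (x ∷ xs) c f = trans (cong (c * f x +_) (∑-*ˡ xs c f)) (sym (*-distribˡ-+ c (f x) (∑ xs f)))

∑-*ʳ : (xs : List A) (f : A → ℕ) (c : ℕ) → ∑ xs (λ x → f x * c) ≡ ∑ xs f * c
∑-*ʳ []       f c = refl
∑-*ʳ (x ∷ xs) f c = trans (cong (f x * c +_) (∑-*ʳ xs f c)) (sym (*-distribʳ-+ c (f x) (∑ xs f)))

∑-swap : (xs : List A) (ys : List B) (f : A → B → ℕ) →
  ∑ xs (λ x → ∑ ys (f x)) ≡ ∑ ys (λ y → ∑ xs (λ x → f x y))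
∑-swap []       ys f = sym (trans (∑-const ys 0) (*-zeroʳ (length ys)))
∑-swap (x ∷ xs) ys f = trans (cong (∑ ys (f x) +_) (∑-swap xs ys f)) (sym (∑-+ ys (f x) _))

∑-++ : (xs ys : List A) (f : A → ℕ) → ∑ (xs ++ ys) f ≡ ∑ xs f + ∑ ys f
∑-++ xs ys f = trans (cong sum (map-++ f xs ys)) (sum-++ (map f xs) (map f ys))

∑-cartesianProductWith : {C : Set} (c : A → B → C) (xs : List A) (ys : List B) (f : C → ℕ) →
  ∑ (List.cartesianProductWith c xs ys) f ≡ ∑ xs (λ x → ∑ ys (λ y → f (c x y)))
∑-cartesianProductWith c []       ys f = refl
∑-cartesianProductWith c (x ∷ xs) ys f = trans (∑-++ (map (c x) ys) _ f)
  (cong₂ _+_ (cong sum (sym (map-∘ ys))) (∑-cartesianProductWith c xs ys f))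

-- Averaging: strict reverse inequalities at all entries would add up to one between the sums.
∑≤∑⇒∃≤ : (xs : List A) → 0 < length xs → (f g : A → ℕ) → ∑ xs f ≤ ∑ xs g → ∃[ x ] (x ∈ xs × f x ≤ g x)
∑≤∑⇒∃≤ {A} (x₀ ∷ xs₀) _ f g = go x₀ xs₀
  where
  go : ∀ x (xs : List A) → ∑ (x ∷ xs) f ≤ ∑ (x ∷ xs) g → ∃[ z ] (z ∈ x ∷ xs × f z ≤ g z)
  go x []       le = x , here refl , subst₂ _≤_ (+-identityʳ (f x)) (+-identityʳ (g x)) le
  go x (y ∷ xs) le with ∑ (y ∷ xs) f ≤? ∑ (y ∷ xs) g
  ... | yes le′ with z , z∈xs , fz≤gz ← go y xs le′ = z , there z∈xs , fz≤gz
  ... | no  nle = x , here refl , ≮⇒≥ λ gx<fx → <⇒≱ (+-mono-< gx<fx (≰⇒> nle)) le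

length-filter-∑ : {P : Pred A 0ℓ} (P? : Decidable P) (xs : List A) → length (filter P? xs) ≡ ∑ xs (λ x → ⟦ P? x ⟧)
length-filter-∑ P? []       = refl
length-filter-∑ P? (x ∷ xs) with P? x
... | yes _ = cong suc (length-filter-∑ P? xs)
... | no _  = length-filter-∑ P? xs

length-filter-complement : {P : Pred A 0ℓ} (P? : Decidable P) (xs : List A) →
  length (filter P? xs) + length (filter (¬? ∘ P?) xs) ≡ length xs
length-filter-complement P? []       = refl
length-filter-complement P? (x ∷ xs) with P? x
... | yes _ = cong suc (length-filter-complement P? xs)
... | no _  = trans (+-suc _ _) (cong suc (length-filter-complement P? xs))

-- Raising both numbers by one adds `2 * (a + b + 1)` to both sides, so no difference has to be
-- squared.
2ab≤a²+b² : ∀ a b → 2 * (a * b) ≤ a * a + b * b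
2ab≤a²+b² zero    b       = z≤n
2ab≤a²+b² (suc a) zero    = ≤-trans (≤-reflexive (cong (2 *_) (*-zeroʳ a))) z≤n
2ab≤a²+b² (suc a) (suc b) = subst₂ _≤_ (lhs a b) (rhs a b) (+-monoˡ-≤ (2 * (a + b + 1)) (2ab≤a²+b² a b))
  where
  open +-*-Solver
  lhs = solve 2 (λ a b → con 2 :* (a :* b) :+ con 2 :* (a :+ b :+ con 1) := con 2 :* ((con 1 :+ a) :* (con 1 :+ b))) refl
  rhs = solve 2 (λ a b → a :* a :+ b :* b :+ con 2 :* (a :+ b :+ con 1) :=
    (con 1 :+ a) :* (con 1 :+ a) :+ (con 1 :+ b) :* (con 1 :+ b)) refl

-- The other factor is the constant 1. The cross terms of a new entry are absorbed one by one by
-- `2ab≤a²+b²`.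
cauchy-schwarz : (xs : List A) (f : A → ℕ) → ∑ xs f * ∑ xs f ≤ length xs * ∑ xs (λ x → f x * f x)
cauchy-schwarz []       f = z≤n
cauchy-schwarz (x ∷ xs) f = begin
  (a + s) * (a + s)                                  ≡⟨ expand a s ⟩
  a * a + (2 * (a * s) + s * s)                      ≤⟨ +-monoʳ-≤ (a * a) (+-mono-≤ cross (cauchy-schwarz xs f)) ⟩
  a * a + ((n * (a * a) + Q) + n * Q)                ≡⟨ collect a n Q ⟩
  suc n * (a * a + Q)                                ∎
  where
  open ≤-Reasoning
  open +-*-Solver using (solve; _:=_; _:+_; _:*_; con)
  a = f x
  s = ∑ xs f
  n = length xs
  Q = ∑ xs (λ y → f y * f y)
  expand = solve 2 (λ a s → (a :+ s) :* (a :+ s) := a :* a :+ (con 2 :* (a :* s) :+ s :* s)) refl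
  collect = solve 3 (λ a n Q → a :* a :+ ((n :* (a :* a) :+ Q) :+ n :* Q) := (con 1 :+ n) :* (a :* a :+ Q)) refl
  cross : 2 * (a * s) ≤ n * (a * a) + Q
  cross = begin
    2 * (a * s)                     ≡⟨ cong (2 *_) (∑-*ˡ xs a f) ⟨
    2 * ∑ xs (λ y → a * f y)        ≡⟨ ∑-*ˡ xs 2 _ ⟨
    ∑ xs (λ y → 2 * (a * f y))      ≤⟨ ∑-mono xs (λ {y} _ → 2ab≤a²+b² a (f y)) ⟩
    ∑ xs (λ y → a * a + f y * f y)  ≡⟨ ∑-+ xs _ _ ⟩
    ∑ xs (λ _ → a * a) + Q          ≡⟨ cong (_+ Q) (∑-const xs (a * a)) ⟩
    n * (a * a) + Q                 ∎

length-allFin : ∀ n → length (allFin n) ≡ n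
length-allFin n = length-tabulate {n = n} (λ i → i)

∑-allFin-suc : ∀ {n} (f : Fin (suc n) → ℕ) → ∑ (allFin (suc n)) f ≡ f zero + ∑ (allFin n) (f ∘ suc)
∑-allFin-suc {n} f = cong (λ xs → f zero + sum xs) (trans (map-tabulate suc f) (sym (map-tabulate (λ i → i) (f ∘ suc))))

∑-pick : ∀ {n} (i : Fin n) (f : Fin n → ℕ) → ∑ (allFin n) (λ j → ⟦ i Fin.≟ j ⟧ * f j) ≡ f i
∑-pick {suc n} zero    f = trans (∑-allFin-suc {n} (λ j → ⟦ zero Fin.≟ j ⟧ * f j)) (trans (cong₂ _+_ (+-identityʳ (f zero))
  (trans (∑-const (allFin n) 0) (*-zeroʳ (length (allFin n))))) (+-identityʳ (f zero)))
∑-pick {suc n} (suc i) f = trans (∑-allFin-suc {n} (λ j → ⟦ suc i Fin.≟ j ⟧ * f j)) (∑-pick i (f ∘ suc))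

-- Cauchy-Schwarz for the class sizes: the sum of their squares counts ordered pairs in a common
-- class, those with `x = y` included.
class-collisions : ∀ {N} (c : A → Fin N) (U : List A) →
  length U * length U ≤ N * ∑ U (λ x → ∑ U (λ y → ⟦ c x Fin.≟ c y ⟧))
class-collisions {N = N} c U = begin
  length U * length U                                     ≡⟨ cong (λ z → z * z) (sym sizes) ⟩
  ∑ I size * ∑ I size                                     ≤⟨ cauchy-schwarz I size ⟩
  length I * ∑ I (λ i → size i * size i)                  ≡⟨ cong₂ _*_ (length-allFin N) collisions ⟩
  N * ∑ U (λ x → ∑ U (λ y → ⟦ c x Fin.≟ c y ⟧))           ∎
  where
  open ≤-Reasoning
  I = allFin N
  size : Fin N → ℕ
  size i = ∑ U (λ x → ⟦ c x Fin.≟ i ⟧)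
  sizes : ∑ I size ≡ length U
  sizes = trans (∑-swap I U _) (trans (∑-cong U λ x → trans (∑-cong I (λ i → sym (*-identityʳ _))) (∑-pick (c x) (λ _ → 1)))
    (trans (∑-const U 1) (*-identityʳ _)))
  collisions : ∑ I (λ i → size i * size i) ≡ ∑ U (λ x → ∑ U (λ y → ⟦ c x Fin.≟ c y ⟧))
  collisions = trans (∑-cong I (λ i → sym (∑-*ʳ U _ (size i)))) (trans (∑-swap I U _)
    (∑-cong U λ x → trans (∑-pick (c x) size) (∑-cong U λ y → ⟦≟⟧-comm (c y) (c x))))
    where
    ⟦≟⟧-comm : ∀ {n} (i j : Fin n) → ⟦ i Fin.≟ j ⟧ ≡ ⟦ j Fin.≟ i ⟧
    ⟦≟⟧-comm i j with j Fin.≟ i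
    ... | yes eq = ⟦⟧-yes (i Fin.≟ j) (sym eq)
    ... | no ne  = ⟦⟧-no (i Fin.≟ j) (ne ∘ sym)

-- Counting by branching on elements

-- The recursion behind both branching counts: each branch lowers the base, and taking the element
-- lowers the exponent as well.
power-split : ∀ M x h → M * x ^ h + M * x ^ suc h ≤ M * suc x ^ suc h
power-split M x h = begin
  M * x ^ h + M * x ^ suc h  ≡⟨ *-distribˡ-+ M (x ^ h) (x ^ suc h) ⟨
  M * (suc x * x ^ h)        ≤⟨ *-monoʳ-≤ M (*-monoʳ-≤ (suc x) (^-monoˡ-≤ h (n≤1+n x))) ⟩
  M * suc x ^ suc h          ∎
  where open ≤-Reasoning

module Counting {A : Set} where

  -- Distinctness with a witness in `U`, so that `U` can shrink to where the sets of a list may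
  -- still differ.
  DiffOn : List A → (A → Bool) → (A → Bool) → Set
  DiffOn U P Q = ∃[ x ] (x ∈ U × P x ≢ Q x)

  length≤1 : ∀ {L} → AllPairs (DiffOn []) L → length L ≤ 1
  length≤1 []                       = z≤n
  length≤1 ([] ∷ _)                 = ≤-refl
  length≤1 (((_ , () , _) ∷ _) ∷ _)

  refine : ∀ {R R′ : (A → Bool) → (A → Bool) → Set} {Φ : (A → Bool) → Set} {L} →
    (∀ {P Q} → Φ P → Φ Q → R P Q → R′ P Q) → All Φ L → AllPairs R L → AllPairs R′ L
  refine f []       []       = []
  refine f (φ ∷ φs) (r ∷ rs) = All.map (λ (φ′ , r′) → f φ φ′ r′) (All.zip (φs , r)) ∷ refine f φs rs

  -- Splits `L` by the value at `v`. In each half every difference lies in the region `U₁` or `U₀`,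
  -- so the half stays pairwise distinct there.
  branch : ∀ v {U U₁ U₀ : List A} {Φ : (A → Bool) → Set} {L a b} → AllPairs (DiffOn U) L → All Φ L →
    (∀ {P Q : A → Bool} {x} → Φ P → Φ Q → P v ≡ true → Q v ≡ true → P x ≢ Q x → x ∈ U → x ∈ U₁) →
    (∀ {P Q : A → Bool} {x} → P v ≡ Q v → P x ≢ Q x → x ∈ U → x ∈ U₀) →
    (∀ {L₁} → AllPairs (DiffOn U₁) L₁ → All (λ P → Φ P × P v ≡ true) L₁ → length L₁ ≤ a) →
    (∀ {L₀} → AllPairs (DiffOn U₀) L₀ → All Φ L₀ → length L₀ ≤ b) →
    length L ≤ a + b
  branch v {L = L} diff φs in₁ in₀ bound₁ bound₀ = subst (_≤ _) (length-filter-complement v? L)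
    (+-mono-≤
      (bound₁ (refine (λ {P} {Q} (φ , p) (φ′ , q) (x , x∈U , ne) → x , in₁ {P} {Q} φ φ′ p q ne x∈U , ne) φ₁
        (AllPairs.filter⁺ v? diff)) φ₁)
      (bound₀ (refine (λ {P} {Q} p q (x , x∈U , ne) → x , in₀ {P} {Q} (agree p q) ne x∈U , ne)
        (All.all-filter (¬? ∘ v?) L) (AllPairs.filter⁺ (¬? ∘ v?) diff)) (All.filter⁺ (¬? ∘ v?) φs)))
    where
    v? : ∀ P → Dec (P v ≡ true)
    v? P = P v Bool.≟ true
    φ₁ = All.zip (All.filter⁺ v? φs , All.all-filter v? L)
    agree : ∀ {b c} → b ≢ true → c ≢ true → b ≡ c
    agree {false} {false} _ _ = refl
    agree {true}          p _ = contradiction refl p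
    agree {false} {true}  _ q = contradiction refl q

  drop-head : ∀ {v x U} (P Q : A → Bool) → P v ≡ Q v → P x ≢ Q x → x ∈ v ∷ U → x ∈ U
  drop-head P Q eq ne (here refl) = contradiction eq ne
  drop-head P Q eq ne (there x∈U) = x∈U

  count≤2^ : ∀ U {L} → AllPairs (DiffOn U) L → length L ≤ 2 ^ length U
  count≤2^ []      diff = length≤1 diff
  count≤2^ (v ∷ U) diff = ≤-trans
    (branch v {Φ = λ _ → ⊤} diff (All.universal (λ _ → tt) _)
      (λ {P} {Q} _ _ p q → drop-head P Q (trans p (sym q))) (λ {P} {Q} → drop-head P Q)
      (λ diff′ _ → count≤2^ U diff′) (λ diff′ _ → count≤2^ U diff′))
    (+-monoʳ-≤ (2 ^ length U) (≤-reflexive (sym (+-identityʳ _))))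

  Contains : List A → (A → Bool) → Set
  Contains S P = All (λ s → P s ≡ true) S

  -- U is the part of the enumeration not yet visited, and S lists the elements of the visited part that
  -- belong to the members of L; all of them agree on the visited part.
  count-by-prefix : ∀ {n m M} {Φ : (A → Bool) → Set} → 1 ≤ M →
    (∀ S U {L} → length S ≡ n → Unique S → Unique U → (∀ {x} → x ∈ U → All (_≢ x) S) → length U ≤ m →
      AllPairs (DiffOn U) L → All (λ P → Φ P × Contains S P) L → length L ≤ M) →
    ∀ j S U {L} → j + length S ≡ n → Unique S → Unique U → (∀ {x} → x ∈ U → All (_≢ x) S) → length U ≤ m →
    AllPairs (DiffOn U) L → All (λ P → Φ P × Contains S P) L → length L ≤ M * suc (length U) ^ j
  count-by-prefix {M = M} 1≤M bound zero S U len uS uU disj U≤m diff φs =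
    ≤-trans (bound S U len uS uU disj U≤m diff φs) (≤-reflexive (sym (*-identityʳ M)))
  -- The enumeration ends before `n` elements are found: no place is left where two members could
  -- differ.
  count-by-prefix {M = M} 1≤M bound (suc j) S [] len uS uU disj U≤m diff φs =
    ≤-trans (length≤1 diff) (*-mono-≤ 1≤M (m^n>0 1 (suc j)))
  count-by-prefix {M = M} {Φ} 1≤M bound (suc j) S (v ∷ U) len uS (v∉U ∷ uU) disj U≤m diff φs = ≤-trans
    (branch v diff φs (λ {P} {Q} _ _ p q → drop-head P Q (trans p (sym q))) (λ {P} {Q} → drop-head P Q)
      (λ diff′ φs′ → count-by-prefix {Φ = Φ} 1≤M bound j (v ∷ S) U (trans (+-suc j _) len)
        (All.map ≢-sym (disj (here refl)) ∷ uS) uU (λ x∈U → All.lookup v∉U x∈U ∷ disj (there x∈U)) (≤-trans (n≤1+n _) U≤m)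
        diff′ (All.map (λ ((φ , c) , p) → φ , p ∷ c) φs′))
      (λ diff′ φs′ → count-by-prefix {Φ = Φ} 1≤M bound (suc j) S U len uS uU (disj ∘ there) (≤-trans (n≤1+n _) U≤m) diff′ φs′))
    (power-split M (suc (length U)) j)

  -- The density hypothesis `shrink`: beyond `N` vertices, some vertex has so many neighbours that
  -- deleting them leaves at most `κ / suc κ` of the excess over `N`.
  module Containers (_≟_ : DecidableEquality A) {adj : A → A → Set} (adj? : ∀ x y → Dec (adj x y)) (N κ : ℕ)
    (shrink : ∀ U → Unique U → N < length U → ∃[ v ] (v ∈ U ×
      suc κ * (length (filter (¬? ∘ adj? v) U) ∸ N) ≤ κ * (length U ∸ N))) where

    -- Independence in the graph; `x ≢ y` is demanded because the graph used later has loops.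
    Stable : List A → (A → Bool) → Set
    Stable U P = ∀ x y → x ∈ U → y ∈ U → x ≢ y → adj x y → P x ≡ true → P y ≢ true

    stable-⊆ : ∀ {U U′} → (∀ {x} → x ∈ U′ → x ∈ U) → ∀ {P} → Stable U P → Stable U′ P
    stable-⊆ sub st x y x∈ y∈ = st x y (sub x∈) (sub y∈)

    count-within : ∀ h w U {L} → length U ≤ N → AllPairs (DiffOn U) L → length L ≤ 2 ^ N * suc w ^ h
    count-within h w U U≤N diff =
      ≤-trans (count≤2^ U diff) (≤-trans (^-monoʳ-≤ 2 U≤N) (m≤m*n (2 ^ N) (suc w ^ h) {{m^n≢0 (suc w) h}}))

    -- `w` bounds the excess of `U` over `N`, and `h` the number of vertices still to be taken. The
    -- inequality between powers says that `h` shrinkings bring the excess below 1.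
    Bound : ℕ → ℕ → Set
    Bound h w = ∀ U {L} → Unique U → length U ≤ N + w → w * κ ^ h < suc κ ^ h →
      AllPairs (DiffOn U) L → All (Stable U) L → length L ≤ 2 ^ N * suc w ^ h

    -- Branch on a vertex v of large degree: sets avoiding v live on U \ {v}, sets containing v
    -- live on U minus the neighbours of v, whose excess over N is smaller by the factor κ/(κ+1).
    bound-step : ∀ h w → (∀ w′ → Bound h w′) → Bound (suc h) w → Bound (suc h) (suc w)
    bound-step h w IH₁ IH₀ U {L} uU U≤ small diff st =
      [ (λ U≤N → count-within (suc h) (suc w) U U≤N diff) , step ]′ (≤-<-connex (length U) N)
      where
      step : N < length U → length L ≤ 2 ^ N * suc (suc w) ^ suc h
      step N<U = ≤-trans
        (branch v {U₁ = U₁} {U₀ = U₀} {a = 2 ^ N * suc w ^ h} diff st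
          (λ {P} {Q} st₁ st₂ p q ne x∈U → ∈-filter⁺ (¬? ∘ adj? v) x∈U (λ vx → ne (agree {P} {Q} st₁ st₂ p q vx x∈U)))
          (λ {P} {Q} eq ne x∈U → ∈-filter⁺ (¬? ∘ (v ≟_)) x∈U (λ v≡x → ne (subst (λ z → P z ≡ Q z) v≡x eq)))
          (λ diff′ st′ → ≤-trans
            (IH₁ w₁ U₁ (Unique.filter⁺ (¬? ∘ adj? v) uU) (m≤n+m∸n (length U₁) N) small₁ diff′
              (All.map (λ {P} (s , _) → stable-⊆ sub₁ {P} s) st′))
            (*-monoʳ-≤ (2 ^ N) (^-monoˡ-≤ h w₁≤w)))
          (λ diff′ st′ → IH₀ U₀ (Unique.filter⁺ (¬? ∘ (v ≟_)) uU) U₀≤ (≤-<-trans (m≤n+m _ _) small) diff′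
            (All.map (λ {P} → stable-⊆ sub₀ {P}) st′)))
        (power-split (2 ^ N) (suc w) h)
        where
        pivot = shrink U uU N<U
        v = proj₁ pivot
        v∈U = proj₁ (proj₂ pivot)
        shrunk = proj₂ (proj₂ pivot)
        U₁ = filter (¬? ∘ adj? v) U
        U₀ = filter (¬? ∘ (v ≟_)) U
        w₁ = length U₁ ∸ N
        sub₁ : ∀ {x} → x ∈ U₁ → x ∈ U
        sub₁ = proj₁ ∘ ∈-filter⁻ (¬? ∘ adj? v)
        sub₀ : ∀ {x} → x ∈ U₀ → x ∈ U
        sub₀ = proj₁ ∘ ∈-filter⁻ (¬? ∘ (v ≟_))
        agree : ∀ {P Q x} → Stable U P → Stable U Q → P v ≡ true → Q v ≡ true → adj v x → x ∈ U → P x ≡ Q x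
        agree {P} {Q} {x} st₁ st₂ p q vx x∈U with v ≟ x
        ... | yes refl = trans p (sym q)
        ... | no v≢x with P x in eq₁ | Q x in eq₂
        ... | true  | _     = contradiction eq₁ (st₁ v x v∈U x∈U v≢x vx p)
        ... | false | true  = contradiction eq₂ (st₂ v x v∈U x∈U v≢x vx q)
        ... | false | false = refl
        U₀≤ : length U₀ ≤ N + w
        U₀≤ = s≤s⁻¹ (≤-trans (filter-notAll (¬? ∘ (v ≟_)) U (Any.map (λ v≡y ¬eq → ¬eq v≡y) v∈U))
          (≤-trans U≤ (≤-reflexive (+-suc N w))))
        excess : suc κ * w₁ ≤ κ * suc w
        excess = ≤-trans shrunk (*-monoʳ-≤ κ (≤-trans (∸-monoˡ-≤ N U≤) (≤-reflexive (m+n∸m≡n N (suc w)))))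
        w₁≤w : suc w₁ ≤ suc w
        w₁≤w = *-cancelˡ-< (suc κ) w₁ (suc w) (≤-<-trans excess (m<n+m (κ * suc w) z<s))
        -- Taking `v` uses up one of the `suc h` shrinkings; the factor gained in `excess` restores
        -- the inequality for `h`.
        small₁ : w₁ * κ ^ h < suc κ ^ h
        small₁ = *-cancelˡ-< (suc κ) (w₁ * κ ^ h) (suc κ ^ h) (≤-<-trans (begin
          suc κ * (w₁ * κ ^ h) ≡⟨ *-assoc (suc κ) w₁ (κ ^ h) ⟨
          suc κ * w₁ * κ ^ h   ≤⟨ *-monoˡ-≤ (κ ^ h) excess ⟩
          κ * suc w * κ ^ h    ≡⟨ cong (_* κ ^ h) (*-comm κ (suc w)) ⟩
          suc w * κ * κ ^ h    ≡⟨ *-assoc (suc w) κ (κ ^ h) ⟩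
          suc w * (κ * κ ^ h)  ∎) small)
          where open ≤-Reasoning

    count-stable : ∀ h w → Bound h w
    count-stable zero    zero    U uU U≤ small diff st = count-within 0 0 U (≤-trans U≤ (≤-reflexive (+-identityʳ N))) diff
    count-stable (suc h) zero    U uU U≤ small diff st = count-within (suc h) 0 U (≤-trans U≤ (≤-reflexive (+-identityʳ N))) diff
    -- With `h = 0` the hypothesis would say `suc w < 1`.
    count-stable zero    (suc w) U uU U≤ (s≤s ()) diff st
    count-stable (suc h) (suc w) = bound-step h w (count-stable h) (count-stable (suc h) w)

-- Supersaturation

∑-≟≤1 : {A : Set} (_≟_ : DecidableEquality A) (x : A) {U : List A} → Unique U → ∑ U (λ y → ⟦ x ≟ y ⟧) ≤ 1
∑-≟≤1 _≟_ x {[]}    []        = z≤n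
∑-≟≤1 _≟_ x {y ∷ U} (y∉U ∷ uU) with x ≟ y
... | no _     = ∑-≟≤1 _≟_ x uU
... | yes refl = s≤s (≤-trans (∑-mono U (λ z∈U → ≤-reflexive (⟦⟧-no (x ≟ _) (All.lookup y∉U z∈U))))
  (≤-reflexive (trans (∑-const U 0) (*-zeroʳ (length U)))))

∸-transpose : ∀ a b N {u} → a + b ≡ u → b ∸ N ≡ u ∸ N ∸ a
∸-transpose a b N refl = begin
  b ∸ N             ≡⟨ cong (_∸ N) (m+n∸m≡n a b) ⟨
  a + b ∸ a ∸ N     ≡⟨ ∸-+-assoc (a + b) a N ⟩
  a + b ∸ (a + N)   ≡⟨ cong (a + b ∸_) (+-comm a N) ⟩
  a + b ∸ (N + a)   ≡⟨ ∸-+-assoc (a + b) N a ⟨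
  a + b ∸ N ∸ a     ∎
  where open ≡-Reasoning

-- A degree `a` of at least `(u ∸ N) / suc κ` takes that share of the excess away. Truncated
-- subtraction covers a rest `b` below `N`.
excess-shrinks : ∀ κ N a b {u} → a + b ≡ u → u ≤ N + suc κ * a → suc κ * (b ∸ N) ≤ κ * (u ∸ N)
excess-shrinks κ N a b {u} a+b≡u u≤ = begin
  suc κ * (b ∸ N)              ≡⟨ cong (suc κ *_) (∸-transpose a b N a+b≡u) ⟩
  suc κ * (u ∸ N ∸ a)          ≡⟨ *-distribˡ-∸ (suc κ) (u ∸ N) a ⟩
  suc κ * (u ∸ N) ∸ suc κ * a  ≤⟨ ∸-monoʳ-≤ (suc κ * (u ∸ N)) (m≤n+o⇒m∸n≤o u N u≤) ⟩
  suc κ * (u ∸ N) ∸ (u ∸ N)    ≡⟨ m+n∸m≡n (u ∸ N) (κ * (u ∸ N)) ⟩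
  κ * (u ∸ N)                  ∎
  where open ≤-Reasoning

-- Each `T` in `𝒯` partitions the points into `N` classes, and two different points share a class
-- for at most a share `D / t` of the partitions. Factors `t` replace fractions throughout.
module Supersaturation {A B : Set} (_≟_ : DecidableEquality A) {N : ℕ} (cl : B → A → Fin N) (𝒯 : List B) (t D κ : ℕ)
  (0<𝒯 : 0 < length 𝒯) (0<t : 0 < t)
  (multiplicity : ∀ {x y} → x ≢ y → ∑ 𝒯 (λ T → ⟦ cl T x Fin.≟ cl T y ⟧) * t ≤ D * length 𝒯)
  (ND≤Kt : N * D ≤ suc κ * t) where

  adj : A → A → Set
  adj x y = Any (λ T → cl T x ≡ cl T y) 𝒯

  adj? : ∀ x y → Dec (adj x y)
  adj? x y = Any.any? (λ T → cl T x Fin.≟ cl T y) 𝒯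

  private
    θ = length 𝒯
    instance
      θ≢0 : NonZero θ
      θ≢0 = >-nonZero 0<𝒯
      t≢0 : NonZero t
      t≢0 = >-nonZero 0<t

  mult : A → A → ℕ
  mult x y = ∑ 𝒯 (λ T → ⟦ cl T x Fin.≟ cl T y ⟧)

  deg : List A → A → ℕ
  deg U x = ∑ U (λ y → ⟦ adj? x y ⟧)

  -- Up to the factor `t`: equal points share a class for all `θ` partitions, adjacent ones for at
  -- most a share `D / t`, all others for none.
  mult-bound : ∀ x y → mult x y * t ≤ θ * t * ⟦ x ≟ y ⟧ + D * θ * ⟦ adj? x y ⟧
  mult-bound x y with x ≟ y
  ... | yes _ = ≤-trans (*-monoˡ-≤ t mult≤θ) (≤-trans (≤-reflexive (sym (*-identityʳ (θ * t)))) (m≤m+n _ _))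
    where
    mult≤θ : mult x y ≤ θ
    mult≤θ = ≤-trans (∑-mono 𝒯 (λ {T} _ → ⟦⟧≤1 (cl T x Fin.≟ cl T y))) (≤-reflexive (trans (∑-const 𝒯 1) (*-identityʳ θ)))
  ... | no x≢y with adj? x y
  ...   | yes _ = ≤-trans (multiplicity x≢y) (≤-trans (≤-reflexive (sym (*-identityʳ (D * θ)))) (m≤n+m _ (θ * t * 0)))
  ...   | no ¬xy = ≤-trans (*-monoˡ-≤ t mult≤0) z≤n
    where
    mult≤0 : mult x y ≤ 0
    mult≤0 = ≤-trans (∑-mono 𝒯 (λ {T} T∈𝒯 → ≤-reflexive (⟦⟧-no (cl T x Fin.≟ cl T y) (¬xy ∘ lose T∈𝒯))))
      (≤-reflexive (trans (∑-const 𝒯 0) (*-zeroʳ θ)))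

  ∑-mult-bound : ∀ {U} → Unique U → ∀ x → ∑ U (λ y → mult x y * t) ≤ θ * t + D * θ * deg U x
  ∑-mult-bound {U} uU x = begin
    ∑ U (λ y → mult x y * t)                                        ≤⟨ ∑-mono U (λ {y} _ → mult-bound x y) ⟩
    ∑ U (λ y → θ * t * ⟦ x ≟ y ⟧ + D * θ * ⟦ adj? x y ⟧)            ≡⟨ ∑-+ U _ _ ⟩
    ∑ U (λ y → θ * t * ⟦ x ≟ y ⟧) + ∑ U (λ y → D * θ * ⟦ adj? x y ⟧) ≡⟨ cong₂ _+_ (∑-*ˡ U (θ * t) _) (∑-*ˡ U (D * θ) _) ⟩
    θ * t * ∑ U (λ y → ⟦ x ≟ y ⟧) + D * θ * deg U x                 ≤⟨ +-monoˡ-≤ _ (*-monoʳ-≤ (θ * t) (∑-≟≤1 _≟_ x uU)) ⟩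
    θ * t * 1 + D * θ * deg U x                                     ≡⟨ cong (_+ D * θ * deg U x) (*-identityʳ (θ * t)) ⟩
    θ * t + D * θ * deg U x                                         ∎
    where open ≤-Reasoning

  -- `class-collisions` for each `T`, summed over `𝒯`; exchanging sums turns this into a count by
  -- pairs of points.
  collisions : ∀ U → θ * (length U * length U) ≤ N * ∑ U (λ x → ∑ U (mult x))
  collisions U = begin
    θ * (length U * length U)                             ≡⟨ ∑-const 𝒯 _ ⟨
    ∑ 𝒯 (λ _ → length U * length U)                       ≤⟨ ∑-mono 𝒯 (λ {T} _ → class-collisions (cl T) U) ⟩
    ∑ 𝒯 (λ T → N * ∑ U (λ x → ∑ U (λ y → same T x y)))    ≡⟨ ∑-*ˡ 𝒯 N _ ⟩
    N * ∑ 𝒯 (λ T → ∑ U (λ x → ∑ U (λ y → same T x y)))    ≡⟨ cong (N *_) (∑-swap 𝒯 U _) ⟩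
    N * ∑ U (λ x → ∑ 𝒯 (λ T → ∑ U (λ y → same T x y)))    ≡⟨ cong (N *_) (∑-cong U (λ x → ∑-swap 𝒯 U _)) ⟩
    N * ∑ U (λ x → ∑ U (mult x))                          ∎
    where
    open ≤-Reasoning
    same : B → A → A → ℕ
    same T x y = ⟦ cl T x Fin.≟ cl T y ⟧

  -- Compares `collisions` with `∑-mult-bound`. The left side stays a sum of a constant over `U` so
  -- that averaging over the vertices applies.
  degree-sum : ∀ {U} → Unique U → ∑ U (λ _ → θ * (length U * t)) ≤ ∑ U (λ x → N * (θ * t + D * θ * deg U x))
  degree-sum {U} uU = begin
    ∑ U (λ _ → θ * (u * t))                      ≡⟨ ∑-const U _ ⟩
    u * (θ * (u * t))                            ≡⟨ solve 3 (λ u θ t → u :* (θ :* (u :* t)) := θ :* (u :* u) :* t) refl u θ t ⟩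
    θ * (u * u) * t                              ≤⟨ *-monoˡ-≤ t (collisions U) ⟩
    N * ∑ U (λ x → ∑ U (mult x)) * t             ≡⟨ *-assoc N _ t ⟩
    N * (∑ U (λ x → ∑ U (mult x)) * t)           ≡⟨ cong (N *_) (sym (∑-*ʳ U _ t)) ⟩
    N * ∑ U (λ x → ∑ U (mult x) * t)             ≡⟨ cong (N *_) (∑-cong U (λ x → sym (∑-*ʳ U (mult x) t))) ⟩
    N * ∑ U (λ x → ∑ U (λ y → mult x y * t))     ≤⟨ *-monoʳ-≤ N (∑-mono U (λ {x} _ → ∑-mult-bound uU x)) ⟩
    N * ∑ U (λ x → θ * t + D * θ * deg U x)      ≡⟨ ∑-*ˡ U N _ ⟨
    ∑ U (λ x → N * (θ * t + D * θ * deg U x))    ∎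
    where
    open ≤-Reasoning
    open +-*-Solver
    u = length U

  -- At an average vertex, after cancelling `θ` and `t`, the diagonal pairs give the term `N` and
  -- the adjacent pairs give `suc κ * deg U x`.
  large-degree : ∀ U → Unique U → 0 < length U → ∃[ x ] (x ∈ U × length U ≤ N + suc κ * deg U x)
  large-degree U uU 0<u with x , x∈U , le ← ∑≤∑⇒∃≤ U 0<u (λ _ → θ * (length U * t)) (λ x → N * (θ * t + D * θ * deg U x))
      (degree-sum uU)
    = x , x∈U , *-cancelʳ-≤ u (N + suc κ * deg U x) t (begin
      u * t                           ≤⟨ *-cancelˡ-≤ θ (≤-trans le (≤-reflexive (factor N θ t D (deg U x)))) ⟩
      N * t + N * D * deg U x         ≤⟨ +-monoʳ-≤ (N * t) (*-monoˡ-≤ (deg U x) ND≤Kt) ⟩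
      N * t + suc κ * t * deg U x     ≡⟨ collect N t (suc κ) (deg U x) ⟩
      (N + suc κ * deg U x) * t       ∎)
    where
    open ≤-Reasoning
    open +-*-Solver
    u = length U
    factor = solve 5 (λ N θ t D g → N :* (θ :* t :+ D :* θ :* g) := θ :* (N :* t :+ N :* D :* g)) refl
    collect = solve 4 (λ N t K g → N :* t :+ K :* t :* g := (N :+ K :* g) :* t) refl

  -- Neighbours of `v` and survivors of the filter partition `U`, so the degree of `v` is what the
  -- filter removes.
  shrink : ∀ U → Unique U → N < length U → ∃[ v ] (v ∈ U ×
    suc κ * (length (filter (¬? ∘ adj? v) U) ∸ N) ≤ κ * (length U ∸ N))
  shrink U uU N<U = v , proj₁ (proj₂ ld) ,
    excess-shrinks κ N (deg U v) (length (filter (¬? ∘ adj? v) U)) eq (proj₂ (proj₂ ld))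
    where
    ld = large-degree U uU (≤-<-trans z≤n N<U)
    v = proj₁ ld
    eq : deg U v + length (filter (¬? ∘ adj? v) U) ≡ length U
    eq = subst (λ m → m + length (filter (¬? ∘ adj? v) U) ≡ length U) (length-filter-∑ (adj? v) U)
      (length-filter-complement (adj? v) U)

-- Linear algebra over a finite field

-- Vectors are read as numbers in base `q` so that the pigeonhole principle for `Fin` applies to
-- them.
encode : ∀ {q n} → Vec (Fin q) n → Fin (q ^ n)
encode v = funToFin (lookup v)

decode : ∀ {q n} → Fin (q ^ n) → Vec (Fin q) n
decode i = tabulate (finToFun i)

decode-encode : ∀ {q n} (v : Vec (Fin q) n) → decode (encode v) ≡ v
decode-encode v = trans (Vec.tabulate-cong (Fin.finToFun-funToFin (lookup v))) (Vec.tabulate∘lookup v)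

funToFin-cong : ∀ {m n} {f g : Fin m → Fin n} → (∀ i → f i ≡ g i) → funToFin f ≡ funToFin g
funToFin-cong {zero}  f≗g = refl
funToFin-cong {suc m} f≗g = cong₂ Fin.combine (f≗g zero) (funToFin-cong (f≗g ∘ suc))

decode-injective : ∀ q n {i j : Fin (q ^ n)} → decode {q} {n} i ≡ decode j → i ≡ j
decode-injective q n {i} {j} eq = trans (sym (encode-decode i)) (trans (cong encode eq) (encode-decode j))
  where
  encode-decode : ∀ i → encode {q} {n} (decode i) ≡ i
  encode-decode i =
    trans (funToFin-cong (Vec.lookup∘tabulate (finToFun {q} {n} i))) (Fin.funToFin-finToFin {n} {q} i)

-- There are `q ^ n > q ^ m` arguments. This count takes the place of rank arguments below.
vec-pigeonhole : ∀ {q m n} → 1 < q → m < n → (g : Vec (Fin q) n → Vec (Fin q) m) →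
  ∃[ u ] ∃[ v ] (u ≢ v × g u ≡ g v)
vec-pigeonhole {q} {m} {n} 1<q m<n g
  with i , j , i<j , eq ← Fin.pigeonhole (^-monoʳ-< q 1<q m<n) (λ i → encode (g (decode i)))
  = decode i , decode j
  , Fin.<⇒≢ i<j ∘ decode-injective q n
  , trans (sym (decode-encode _)) (trans (cong decode eq) (decode-encode _))

module LinearAlgebra {q : ℕ} (F : FiniteField q) where
  open FiniteField F

  commutativeRing : CommutativeRing _ _
  commutativeRing = record { isCommutativeRing = isCommutativeRing }

  module 𝔽 = CommutativeRing commutativeRing
  open Algebra.Properties.Ring 𝔽.ring using (-1*x≈-x; x∙y⁻¹≈ε⇒x≈y)
  open Algebra.Solver.Ring.NaturalCoefficients.Default 𝔽.commutativeSemiring using (solve; _:=_; _:+_; _:*_)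

  1<q : 1 < q
  1<q = go 0ᶠ 1ᶠ 0≢1
    where
    go : ∀ {n} (x y : Fin n) → x ≢ y → 1 < n
    go {suc (suc n)} x y x≢y = s≤s (s≤s z≤n)
    go {suc zero} zero zero x≢y = contradiction refl x≢y

  private
    V : ℕ → Set
    V = Vec (Fin q)

  _∙_ : ∀ {n} → V n → V n → Fin q
  u ∙ v = dot F u v

  𝟎 : ∀ {n} → V n
  𝟎 {n} = replicate n 0ᶠ

  _≟ⱽ_ : ∀ {n} (u v : V n) → Dec (u ≡ v)
  _≟ⱽ_ = Vec.≡-dec Fin._≟_

  infixl 6 _⊞_·_
  _⊞_·_ : ∀ {n} → V n → Fin q → V n → V n
  u ⊞ c · v = zipWith (λ a b → a +ᶠ (c *ᶠ b)) u v

  dot-⊞ : ∀ {n} (u v w : V n) c → (u ⊞ c · v) ∙ w ≡ (u ∙ w) +ᶠ (c *ᶠ (v ∙ w))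
  dot-⊞ []      []      []      c = sym (trans (𝔽.+-identityˡ _) (𝔽.zeroʳ c))
  dot-⊞ (a ∷ u) (b ∷ v) (x ∷ w) c rewrite dot-⊞ u v w c =
    solve 6 (λ a b x c s t → (((a :+ (c :* b)) :* x) :+ (s :+ (c :* t))) := (((a :* x) :+ s) :+ (c :* ((b :* x) :+ t))))
      refl a b x c (u ∙ w) (v ∙ w)

  dot-𝟎ˡ : ∀ {n} (w : V n) → 𝟎 ∙ w ≡ 0ᶠ
  dot-𝟎ˡ []      = refl
  dot-𝟎ˡ (x ∷ w) = trans (cong₂ _+ᶠ_ (𝔽.zeroˡ x) (dot-𝟎ˡ w)) (𝔽.+-identityˡ _)

  dot-𝟎ʳ : ∀ {n} (w : V n) → w ∙ 𝟎 ≡ 0ᶠ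
  dot-𝟎ʳ []      = refl
  dot-𝟎ʳ (x ∷ w) = trans (cong₂ _+ᶠ_ (𝔽.zeroʳ x) (dot-𝟎ʳ w)) (𝔽.+-identityˡ _)

  *-zero⇒ : ∀ {a b} → b ≢ 0ᶠ → a *ᶠ b ≡ 0ᶠ → a ≡ 0ᶠ
  *-zero⇒ {a} {b} b≢0 ab≡0 with b⁻¹ , bb⁻¹ ← inverse b b≢0 = begin
    a                ≡⟨ 𝔽.*-identityʳ a ⟨
    a *ᶠ 1ᶠ          ≡⟨ cong (a *ᶠ_) bb⁻¹ ⟨
    a *ᶠ (b *ᶠ b⁻¹)  ≡⟨ 𝔽.*-assoc a b b⁻¹ ⟨
    (a *ᶠ b) *ᶠ b⁻¹  ≡⟨ cong (_*ᶠ b⁻¹) ab≡0 ⟩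
    0ᶠ *ᶠ b⁻¹        ≡⟨ 𝔽.zeroˡ b⁻¹ ⟩
    0ᶠ               ∎
    where open ≡-Reasoning

  cancel-coeff : ∀ a {b} → b ≢ 0ᶠ → ∃[ c ] a +ᶠ (c *ᶠ b) ≡ 0ᶠ
  cancel-coeff a {b} b≢0 with b⁻¹ , bb⁻¹ ← inverse b b≢0 = (-ᶠ a) *ᶠ b⁻¹ , (begin
    a +ᶠ (((-ᶠ a) *ᶠ b⁻¹) *ᶠ b) ≡⟨ cong (a +ᶠ_) (𝔽.*-assoc _ _ _) ⟩
    a +ᶠ ((-ᶠ a) *ᶠ (b⁻¹ *ᶠ b)) ≡⟨ cong (λ z → a +ᶠ ((-ᶠ a) *ᶠ z)) (trans (𝔽.*-comm b⁻¹ b) bb⁻¹) ⟩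
    a +ᶠ ((-ᶠ a) *ᶠ 1ᶠ)         ≡⟨ cong (a +ᶠ_) (𝔽.*-identityʳ _) ⟩
    a +ᶠ (-ᶠ a)                 ≡⟨ 𝔽.-‿inverseʳ a ⟩
    0ᶠ                          ∎)
    where open ≡-Reasoning

  -- The coordinate functional at the first entry where the vectors differ.
  separate : ∀ {n} {u v : V n} → u ≢ v → ∃[ w ] w ∙ u ≢ w ∙ v
  separate {u = []}    {[]}    u≢v = contradiction refl u≢v
  separate {u = a ∷ u} {b ∷ v} u≢v with a Fin.≟ b
  ... | no a≢b = 1ᶠ ∷ 𝟎 , λ eq → a≢b (trans (sym (val a u)) (trans eq (val b v)))
    where
    val : ∀ x y → (1ᶠ *ᶠ x) +ᶠ (𝟎 ∙ y) ≡ x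
    val x y = trans (cong₂ _+ᶠ_ (𝔽.*-identityˡ x) (dot-𝟎ˡ y)) (𝔽.+-identityʳ x)
  ... | yes refl with w , w∙u≢w∙v ← separate (u≢v ∘ cong (a ∷_)) =
    0ᶠ ∷ w , λ eq → w∙u≢w∙v (trans (sym (val u)) (trans eq (val v)))
    where
    val : ∀ y → (0ᶠ *ᶠ a) +ᶠ (w ∙ y) ≡ w ∙ y
    val y = trans (cong (_+ᶠ (w ∙ y)) (𝔽.zeroˡ a)) (𝔽.+-identityˡ _)

  nonzero-value : ∀ {n} {φ : V n} → φ ≢ 𝟎 → ∃[ v ] φ ∙ v ≢ 0ᶠ
  nonzero-value {φ = φ} φ≢𝟎 with v , ne ← separate φ≢𝟎 =
    v , λ eq → ne (trans (dot-comm v φ) (trans eq (sym (dot-𝟎ʳ v))))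
    where
    dot-comm : ∀ {n} (u v : V n) → u ∙ v ≡ v ∙ u
    dot-comm []      []      = refl
    dot-comm (a ∷ u) (b ∷ v) = cong₂ _+ᶠ_ (𝔽.*-comm a b) (dot-comm u v)

  Vanishes : ∀ {n k} → V n → Vec (V n) k → Set
  Vanishes φ = VAll.All (λ w → φ ∙ w ≡ 0ᶠ)

  abstract
    -- Among the `q ^ n` functionals two take the same `k` values on `W`; their difference vanishes
    -- there.
    annihilator : ∀ {n k} → k < n → (W : Vec (V n) k) → ∃[ φ ] (φ ≢ 𝟎 × Vanishes φ W)
    annihilator k<n W with φ , ψ , φ≢ψ , eq ← vec-pigeonhole 1<q k<n (λ φ → Vec.map (φ ∙_) W) =
      φ ⊞ (-ᶠ 1ᶠ) · ψ , φ≢ψ ∘ difference φ ψ , vanish W eq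
      where
      minus : ∀ a b → a +ᶠ ((-ᶠ 1ᶠ) *ᶠ b) ≡ a +ᶠ (-ᶠ b)
      minus a b = cong (a +ᶠ_) (-1*x≈-x b)
      difference : ∀ {n} (φ ψ : V n) → φ ⊞ (-ᶠ 1ᶠ) · ψ ≡ 𝟎 → φ ≡ ψ
      difference []      []      _  = refl
      difference (a ∷ φ) (b ∷ ψ) eq = cong₂ _∷_
        (x∙y⁻¹≈ε⇒x≈y a b (trans (sym (minus a b)) (Vec.∷-injectiveˡ eq)))
        (difference φ ψ (Vec.∷-injectiveʳ eq))
      vanish : ∀ {k} (W : Vec _ k) → Vec.map (φ ∙_) W ≡ Vec.map (ψ ∙_) W → Vanishes (φ ⊞ (-ᶠ 1ᶠ) · ψ) W
      vanish []      _  = []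
      vanish (w ∷ W) eq =
        trans (dot-⊞ φ ψ w _) (trans (minus _ _)
          (trans (cong (_+ᶠ (-ᶠ (ψ ∙ w))) (Vec.∷-injectiveˡ eq)) (𝔽.-‿inverseʳ _)))
        ∷ vanish W (Vec.∷-injectiveʳ eq)

  -- Linear independence of W, phrased dually so that no linear combinations of vectors are needed.
  Independent : ∀ {n k} → Vec (V n) k → Set
  Independent W = ∀ c → ∃[ φ ] Vec.map (φ ∙_) W ≡ c

  independent-[] : ∀ {n} → Independent {n} []
  independent-[] [] = 𝟎 , refl

  -- Adding a multiple of `ψ` to `φ` adjusts the value at `s` and leaves the values on `W`
  -- unchanged.
  independent-∷ : ∀ {n k} {W : Vec (V n) k} {ψ s} → Independent W → Vanishes ψ W → ψ ∙ s ≢ 0ᶠ →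
    Independent (s ∷ W)
  independent-∷ {W = W} {ψ} {s} indep vanW ψs≢0 (c ∷ cs) with φ , refl ← indep cs
    with e , eq ← cancel-coeff ((φ ∙ s) +ᶠ (-ᶠ c)) ψs≢0 =
    φ ⊞ e · ψ , cong₂ _∷_ (trans (dot-⊞ φ ψ s e) (x∙y⁻¹≈ε⇒x≈y _ _ (trans rearrange eq))) (agree W vanW)
    where
    rearrange = solve 4 (λ a m e b → ((a :+ (e :* b)) :+ m) := ((a :+ m) :+ (e :* b))) refl (φ ∙ s) (-ᶠ c) e (ψ ∙ s)
    agree : ∀ {k} (W : Vec _ k) → Vanishes ψ W → Vec.map ((φ ⊞ e · ψ) ∙_) W ≡ Vec.map (φ ∙_) W
    agree []      []        = refl
    agree (w ∷ W) (z ∷ van) = cong₂ _∷_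
      (trans (dot-⊞ φ ψ w e) (trans (cong (λ y → (φ ∙ w) +ᶠ (e *ᶠ y)) z)
        (trans (cong ((φ ∙ w) +ᶠ_) (𝔽.zeroʳ e)) (𝔽.+-identityʳ _))))
      (agree W van)

  -- For `k > n` two different value vectors would be realised by the same functional.
  independent⇒≤ : ∀ {n k} {W : Vec (V n) k} → Independent W → k ≤ n
  independent⇒≤ {W = W} indep = ≮⇒≥ λ n<k →
    let c , c′ , c≢c′ , eq = vec-pigeonhole 1<q n<k (proj₁ ∘ indep)
    in c≢c′ (trans (sym (proj₂ (indep c))) (trans (cong (λ φ → Vec.map (φ ∙_) W) eq) (proj₂ (indep c′))))

  -- Otherwise a vector at which `ψ` is nonzero would extend `W` to `n + 1` independent vectors.
  independent⇒¬vanishes : ∀ {n} {W : Vec (V n) n} {ψ} → Independent W → ψ ≢ 𝟎 → ¬ Vanishes ψ W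
  independent⇒¬vanishes {ψ = ψ} indep ψ≢𝟎 van with v , ψv≢0 ← nonzero-value ψ≢𝟎 =
    1+n≰n (independent⇒≤ (independent-∷ {ψ = ψ} {s = v} indep van ψv≢0))

  -- Homogeneous coordinates: an affine condition on `x` becomes a linear one on `hom x`.
  hom : ∀ {d} → V d → V (suc d)
  hom x = 1ᶠ ∷ x

  -- The functional `(1, 0)` is 1 at `hom x`. If `a` separates the points, `(- a ∙ x, a)` vanishes
  -- at `hom x` and not at `hom y`.
  independent-pair : ∀ {d} {x y : V d} → x ≢ y → Independent (hom y ∷ hom x ∷ [])
  independent-pair {x = x} {y} x≢y with a , a∙x≢a∙y ← separate x≢y =
    independent-∷ {ψ = (-ᶠ (a ∙ x)) ∷ a}
      (independent-∷ {ψ = 1ᶠ ∷ 𝟎} independent-[] [] (λ eq → 0≢1 (sym (trans (sym one) eq))))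
      (trans (cong (_+ᶠ (a ∙ x)) (𝔽.*-identityʳ _)) (𝔽.-‿inverseˡ _) ∷ [])
      (λ eq → a∙x≢a∙y (sym (x∙y⁻¹≈ε⇒x≈y _ _ (trans (𝔽.+-comm (a ∙ y) (-ᶠ (a ∙ x)))
          (trans (cong (_+ᶠ (a ∙ y)) (sym (𝔽.*-identityʳ _))) eq)))))
    where
    one : (1ᶠ *ᶠ 1ᶠ) +ᶠ (𝟎 ∙ x) ≡ 1ᶠ
    one = trans (cong₂ _+ᶠ_ (𝔽.*-identityˡ 1ᶠ) (dot-𝟎ˡ x)) (𝔽.+-identityʳ 1ᶠ)

  -- `φ₁` and `φ₂` both vanish on `W`, but only `φ₂` is forced to vanish at a vector `v` with
  -- `φ₁ ∙ v ≢ 0ᶠ`. So they are not proportional, and their combinations up to scaling form a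
  -- projective line with `q + 1` members.
  module Pencil {n k} (2+k≤n : suc (suc k) ≤ n) (W : Vec (V n) k) where
    private
      ann₁ = annihilator (<-trans (n<1+n k) 2+k≤n) W
      φ₁ = proj₁ ann₁
      val = nonzero-value (proj₁ (proj₂ ann₁))
      v = proj₁ val
      ann₂ = annihilator 2+k≤n (v ∷ W)
      φ₂ = proj₁ ann₂

      φ₂∙v≡0 : φ₂ ∙ v ≡ 0ᶠ
      φ₂∙v≡0 = VAll.head (proj₂ (proj₂ ann₂))

      ⊞-zero : ∀ {n} (u w : V n) → u ⊞ 0ᶠ · w ≡ u
      ⊞-zero []      []      = refl
      ⊞-zero (a ∷ u) (b ∷ w) = cong₂ _∷_ (trans (cong (a +ᶠ_) (𝔽.zeroˡ b)) (𝔽.+-identityʳ a)) (⊞-zero u w)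

      -- Evaluation at `v` would give `c = 0`, and then `φ₂` itself would be zero.
      combination≢𝟎 : ∀ c → φ₂ ⊞ c · φ₁ ≢ 𝟎
      combination≢𝟎 c eq = proj₁ (proj₂ ann₂)
        (trans (sym (⊞-zero φ₂ φ₁)) (trans (cong (λ z → φ₂ ⊞ z · φ₁) (sym c≡0)) eq))
        where
        c≡0 : c ≡ 0ᶠ
        c≡0 = *-zero⇒ (proj₂ val) (begin
          c *ᶠ (φ₁ ∙ v)               ≡⟨ 𝔽.+-identityˡ _ ⟨
          0ᶠ +ᶠ (c *ᶠ (φ₁ ∙ v))       ≡⟨ cong (_+ᶠ (c *ᶠ (φ₁ ∙ v))) φ₂∙v≡0 ⟨
          (φ₂ ∙ v) +ᶠ (c *ᶠ (φ₁ ∙ v)) ≡⟨ dot-⊞ φ₂ φ₁ v c ⟨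
          (φ₂ ⊞ c · φ₁) ∙ v           ≡⟨ cong (_∙ v) eq ⟩
          𝟎 ∙ v                       ≡⟨ dot-𝟎ˡ v ⟩
          0ᶠ                          ∎)
          where open ≡-Reasoning

    -- zero stands for the member φ₁ of the pencil and suc c for φ₂ + c φ₁.
    member : Fin (suc q) → V n
    member zero    = φ₁
    member (suc c) = φ₂ ⊞ c · φ₁

    member≢𝟎 : ∀ i → member i ≢ 𝟎
    member≢𝟎 zero    = proj₁ (proj₂ ann₁)
    member≢𝟎 (suc c) = combination≢𝟎 c

    member-vanishes : ∀ i → Vanishes (member i) W
    member-vanishes zero    = proj₂ (proj₂ ann₁)
    member-vanishes (suc c) = VAll.map
      (λ {w} (e₁ , e₂) → trans (dot-⊞ φ₂ φ₁ w c)
        (trans (cong₂ (λ a b → a +ᶠ (c *ᶠ b)) e₂ e₁) (trans (𝔽.+-identityˡ _) (𝔽.zeroʳ c))))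
      (VAll.zip (proj₂ (proj₂ ann₁) , VAll.tail (proj₂ (proj₂ ann₂))))

    -- If `φ₁ ∙ x` is nonzero, solve for `c`. Fixing one member for each `x` is what makes the
    -- pencil define classes.
    through : ∀ x → ∃[ i ] member i ∙ x ≡ 0ᶠ
    through x with (φ₁ ∙ x) Fin.≟ 0ᶠ
    ... | yes eq = zero , eq
    ... | no ne with c , eq ← cancel-coeff (φ₂ ∙ x) ne = suc c , trans (dot-⊞ φ₂ φ₁ x c) eq

-- Sets in general position

lookup-injective : {A : Set} {X : List A} → Unique X → ∀ i j → List.lookup X i ≡ List.lookup X j → i ≡ j
lookup-injective (x∉X ∷ uX) zero    zero    eq = refl
lookup-injective (x∉X ∷ uX) zero    (suc j) eq = contradiction eq (All.lookup x∉X (∈-lookup j))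
lookup-injective (x∉X ∷ uX) (suc i) zero    eq = contradiction (sym eq) (All.lookup x∉X (∈-lookup i))
lookup-injective (x∉X ∷ uX) (suc i) (suc j) eq = cong suc (lookup-injective uX i j eq)

length-cartesianProductWith : {A B C : Set} (f : A → B → C) (xs : List A) (ys : List B) →
  length (cartesianProductWith f xs ys) ≡ length xs * length ys
length-cartesianProductWith f []       ys = refl
length-cartesianProductWith f (x ∷ xs) ys = trans (length-++ (map (f x) ys))
  (cong₂ _+_ (length-map (f x) ys) (length-cartesianProductWith f xs ys))

module Transversals {A : Set} (t : ℕ) where

  -- Cut S into consecutive blocks of length t and choose one element from each of the first j.
  transversals : ∀ j → List A → List (Vec A j)
  transversals zero    S = [] ∷ []
  transversals (suc j) S = cartesianProductWith _∷_ (take t S) (transversals j (drop t S))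

  length-take-block : ∀ j (S : List A) → length S ≡ suc j * t → length (take t S) ≡ t
  length-take-block j S len = trans (length-take t S) (m≤n⇒m⊓n≡m (subst (t ≤_) (sym len) (m≤m+n t (j * t))))

  length-drop-block : ∀ j (S : List A) → length S ≡ suc j * t → length (drop t S) ≡ j * t
  length-drop-block j S len = trans (length-drop t S) (trans (cong (_∸ t) len) (m+n∸m≡n t (j * t)))

  length-transversals : ∀ j (S : List A) → length S ≡ j * t → length (transversals j S) ≡ t ^ j
  length-transversals zero    S len = refl
  length-transversals (suc j) S len = trans (length-cartesianProductWith _∷_ (take t S) (transversals j (drop t S)))
    (cong₂ _*_ (length-take-block j S len) (length-transversals j (drop t S) (length-drop-block j S len)))

  private
    ∈-take : ∀ n {x} {S : List A} → x ∈ take n S → x ∈ S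
    ∈-take n {S = S} x∈ = All.lookup (All.take⁺ n (All.tabulate {xs = S} (λ x∈S → x∈S))) x∈
    ∈-drop : ∀ n {x} {S : List A} → x ∈ drop n S → x ∈ S
    ∈-drop n {S = S} x∈ = All.lookup (All.drop⁺ n (All.tabulate {xs = S} (λ x∈S → x∈S))) x∈
    take-drop-disjoint : ∀ n {x y} {S : List A} → Unique S → x ∈ take n S → y ∈ drop n S → x ≢ y
    take-drop-disjoint (suc n) {S = s ∷ S} (s∉S ∷ uS) (here refl) y∈ = All.lookup s∉S (∈-drop n y∈)
    take-drop-disjoint (suc n) {S = s ∷ S} (s∉S ∷ uS) (there x∈)  y∈ = take-drop-disjoint n uS x∈ y∈

  -- Different blocks of a duplicate-free list have no element in common.
  transversal-unique : ∀ j {S : List A} {T} → Unique S → T ∈ transversals j S → VAll.All (_∈ S) T × VUnique.Unique T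
  transversal-unique zero    uS (here refl) = [] , []
  transversal-unique (suc j) {S} uS T∈
    with s , T′ , s∈ , T′∈ , refl ← ∈-cartesianProductWith⁻ _∷_ (take t S) (transversals j (drop t S)) T∈
    with T′⊆ , uT′ ← transversal-unique j (Unique.drop⁺ t uS) T′∈
    = ∈-take t s∈ ∷ VAll.map (∈-drop t) T′⊆ , VAll.map (take-drop-disjoint t uS s∈) T′⊆ ∷ uT′

open Transversals

-- Enumeration of the space

allVecs : ∀ q d → List (Vec (Fin q) d)
allVecs q zero    = [] ∷ []
allVecs q (suc d) = cartesianProductWith _∷_ (allFin q) (allVecs q d)

∈-allVecs : ∀ {q d} (v : Vec (Fin q) d) → v ∈ allVecs q d
∈-allVecs []      = here refl
∈-allVecs (x ∷ v) = ∈-cartesianProductWith⁺ _∷_ (∈-allFin x) (∈-allVecs v)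

allVecs-unique : ∀ q d → Unique (allVecs q d)
allVecs-unique q zero    = [] ∷ []
allVecs-unique q (suc d) = Unique.cartesianProductWith⁺ _∷_ Vec.∷-injective (Unique.allFin⁺ q) (allVecs-unique q d)

length-allVecs : ∀ q d → length (allVecs q d) ≡ q ^ d
length-allVecs q zero    = refl
length-allVecs q (suc d) = trans (length-cartesianProductWith _∷_ (allFin q) (allVecs q d))
  (cong₂ _*_ (length-allFin q) (length-allVecs q d))

-- Hyperplanes and cohyperplanar points

module Geometry {q : ℕ} (F : FiniteField q) where
  open FiniteField F
  open LinearAlgebra F
  open Algebra.Properties.Ring 𝔽.ring using (+-inverseʳ-unique)
  open Counting

  Zero : ∀ {d} → Vec (Fin q) (suc d) → Point F d → Set
  Zero φ x = φ ∙ hom x ≡ 0ᶠ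

  Zero? : ∀ {d} (φ : Vec (Fin q) (suc d)) x → Dec (Zero φ x)
  Zero? φ x = (φ ∙ hom x) Fin.≟ 0ᶠ

  -- A functional with zero linear part is constant, so it cannot vanish at a point unless it is 0.
  zeros-hyperplane : ∀ {d n} {φ : Vec (Fin q) (suc d)} → φ ≢ 𝟎 → (f : Fin (suc n) → Point F d) →
    (∀ i → Zero φ (f i)) → OnCommonHyperplane F f
  zeros-hyperplane {φ = a₀ ∷ a} φ≢𝟎 f van = a , -ᶠ a₀ , nonzero-entry a≢𝟎 ,
    λ i → +-inverseʳ-unique a₀ (a ∙ f i) (trans (cong (_+ᶠ (a ∙ f i)) (sym (𝔽.*-identityʳ a₀))) (van i))
    where
    nonzero-entry : ∀ {d} {a : Vec (Fin q) d} → a ≢ 𝟎 → NonZeroVec F a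
    nonzero-entry {a = []}    a≢𝟎 = contradiction refl a≢𝟎
    nonzero-entry {a = b ∷ a} a≢𝟎 with b Fin.≟ 0ᶠ
    ... | no b≢0   = zero , b≢0
    ... | yes refl with j , ne ← nonzero-entry (a≢𝟎 ∘ cong (0ᶠ ∷_)) = suc j , ne
    a≢𝟎 : a ≢ 𝟎
    a≢𝟎 refl = φ≢𝟎 (cong (_∷ 𝟎) (begin
      a₀                              ≡⟨ 𝔽.*-identityʳ a₀ ⟨
      a₀ *ᶠ 1ᶠ                        ≡⟨ 𝔽.+-identityʳ _ ⟨
      (a₀ *ᶠ 1ᶠ) +ᶠ 0ᶠ                ≡⟨ cong ((a₀ *ᶠ 1ᶠ) +ᶠ_) (dot-𝟎ˡ (f zero)) ⟨
      (a₀ *ᶠ 1ᶠ) +ᶠ (𝟎 ∙ f zero)      ≡⟨ van zero ⟩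
      0ᶠ                              ∎))
      where open ≡-Reasoning

  -- Any `d + 1` of the zeros would be distinct points of `P` on one hyperplane.
  few-zeros : ∀ {d P X} {φ : Vec (Fin q) (suc d)} → GeneralPosition F d P → Unique X → Contains X P → φ ≢ 𝟎 →
    ∑ X (λ x → ⟦ Zero? φ x ⟧) ≤ d
  few-zeros {d} {P} {X} {φ} gp uX X⊆P φ≢𝟎 = subst (_≤ d) (length-filter-∑ (Zero? φ) X) (≮⇒≥ λ d<Y →
    let f i = List.lookup Y (Fin.inject≤ i d<Y) in
    gp f (λ eq → Fin.inject≤-injective d<Y d<Y _ _ (lookup-injective (Unique.filter⁺ (Zero? φ) uX) _ _ eq))
      (λ i → All.lookup (All.filter⁺ (Zero? φ) X⊆P) (∈-lookup (Fin.inject≤ i d<Y)))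
      (zeros-hyperplane φ≢𝟎 f (λ i → All.lookup (All.all-filter (Zero? φ) X) (∈-lookup (Fin.inject≤ i d<Y)))))
    where Y = filter (Zero? φ) X

  -- `W` holds the vectors already treated and `T` the points still to come; the induction below
  -- moves points from `T` to `W`.
  Cohyperplanar : ∀ {d k j} → Vec (Vec (Fin q) (suc d)) k → Vec (Point F d) j → Set
  Cohyperplanar W T = ∃[ φ ] (φ ≢ 𝟎 × Vanishes φ W × VAll.All (Zero φ) T)

  -- Extending W by one entry of T at a time, the extension stays independent unless the entry
  -- is one of the at most d zeros of a fixed functional that vanishes on W.
  few-cohyperplanar : ∀ {d P} t → GeneralPosition F d P → ∀ j {k} S {W : Vec (Vec (Fin q) (suc d)) k} → Independent W →
    k + j ≡ suc d → length S ≡ j * t → Unique S → Contains S P →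
    {C : Vec (Point F d) j → Set} (C? : ∀ T → Dec (C T)) → (∀ {T} → C T → Cohyperplanar W T) →
    ∑ (transversals t j S) (λ T → ⟦ C? T ⟧) * t ≤ j * d * t ^ j
  few-cohyperplanar {d} t gp zero {k} S {W} indep k+j≡1+d len uS S⊆P C? coh with C? []
  ... | no _  = z≤n
  -- No points are left and `W` consists of `d + 1` independent vectors, so no nonzero functional
  -- vanishes on it.
  ... | yes c with φ , φ≢𝟎 , van , _ ← coh c
    with refl ← trans (sym (+-identityʳ k)) k+j≡1+d = contradiction van (independent⇒¬vanishes indep φ≢𝟎)
  few-cohyperplanar {d} t gp (suc j) {k} S {W} indep k+j≡1+d len uS S⊆P C? coh = begin
    ∑ (transversals t (suc j) S) (λ T → ⟦ C? T ⟧) * t   ≡⟨ cong (_* t) (∑-cartesianProductWith _∷_ S₁ 𝒯 _) ⟩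
    ∑ S₁ inner * t                                      ≡⟨ ∑-*ʳ S₁ inner t ⟨
    ∑ S₁ (λ s → inner s * t)                            ≤⟨ ∑-mono S₁ (λ {s} _ → inner-bound s) ⟩
    ∑ S₁ (λ s → ⟦ Zero? φ s ⟧ * t ^ suc j + j * d * t ^ j) ≡⟨ ∑-+ S₁ _ _ ⟩
    ∑ S₁ (λ s → ⟦ Zero? φ s ⟧ * t ^ suc j) + ∑ S₁ (λ _ → j * d * t ^ j)
      ≡⟨ cong₂ _+_ (∑-*ʳ S₁ _ _) (trans (∑-const S₁ _) (cong (_* (j * d * t ^ j)) (length-take-block t j S len))) ⟩
    ∑ S₁ (λ s → ⟦ Zero? φ s ⟧) * t ^ suc j + t * (j * d * t ^ j)
      ≤⟨ +-monoˡ-≤ _ (*-monoˡ-≤ (t ^ suc j) (few-zeros gp (Unique.take⁺ t uS) (All.take⁺ t S⊆P) φ≢𝟎)) ⟩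
    d * t ^ suc j + t * (j * d * t ^ j)
      ≡⟨ solve 4 (λ d t j p → d :* (t :* p) :+ t :* (j :* d :* p) := (con 1 :+ j) :* d :* (t :* p)) refl d t j (t ^ j) ⟩
    suc j * d * t ^ suc j                               ∎
    where
    open ≤-Reasoning
    open +-*-Solver using (solve; _:=_; _:+_; _:*_; con)
    S₁ = take t S
    𝒯 = transversals t j (drop t S)
    len₂ = length-drop-block t j S len
    ann = annihilator (subst (suc k ≤_) (trans (sym (+-suc k j)) k+j≡1+d) (s≤s (m≤m+n k j))) W
    φ = proj₁ ann
    φ≢𝟎 = proj₁ (proj₂ ann)
    inner = λ s → ∑ 𝒯 (λ T → ⟦ C? (s ∷ T) ⟧)
    inner-bound : ∀ s → inner s * t ≤ ⟦ Zero? φ s ⟧ * t ^ suc j + j * d * t ^ j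
    inner-bound s with Zero? φ s
    -- The zeros of `φ` in the block are few, so all transversals through them may be counted.
    ... | yes _ = begin
      inner s * t                         ≤⟨ *-monoˡ-≤ t (∑-mono 𝒯 (λ {T} _ → ⟦⟧≤1 (C? (s ∷ T)))) ⟩
      ∑ 𝒯 (λ _ → 1) * t                   ≡⟨ cong (_* t) (trans (trans (∑-const 𝒯 1) (*-identityʳ _))
        (length-transversals t j (drop t S) len₂)) ⟩
      t ^ j * t                           ≡⟨ solve 2 (λ t p → p :* t := con 1 :* (t :* p)) refl t (t ^ j) ⟩
      1 * t ^ suc j                       ≤⟨ m≤m+n _ _ ⟩
      1 * t ^ suc j + j * d * t ^ j       ∎
    ... | no φs≢0 = few-cohyperplanar t gp j (drop t S) (independent-∷ {ψ = φ} {s = hom s} indep (proj₂ (proj₂ ann)) φs≢0)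
      (trans (sym (+-suc k j)) k+j≡1+d) len₂ (Unique.drop⁺ t uS) (All.drop⁺ t S⊆P) (C? ∘ (s ∷_))
      (λ c → let ψ , ψ≢𝟎 , vanW , zs = coh c in ψ , ψ≢𝟎 , VAll.head zs ∷ vanW , VAll.tail zs)

  -- Pencils through transversals

  module _ {j : ℕ} where
    private
      d : ℕ
      d = suc j

    -- The chosen hyperplane through `T` and `x`. With `≤-refl`, the `j` points of `T` sit in
    -- dimension `j + 2`, which just leaves room for a pencil.
    pencil-class : Vec (Point F d) j → Point F d → Fin (suc q)
    pencil-class T x = proj₁ (Pencil.through ≤-refl (Vec.map hom T) (hom x))

    -- The common member of the pencil vanishes at `x`, at `y` and on `T`.
    same-class⇒cohyperplanar : ∀ T {x y} → pencil-class T x ≡ pencil-class T y →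
      Cohyperplanar (hom y ∷ hom x ∷ []) T
    same-class⇒cohyperplanar T {x} {y} eq =
      member (pencil-class T x) , member≢𝟎 (pencil-class T x) ,
      subst (λ i → member i ∙ hom y ≡ 0ᶠ) (sym eq) (proj₂ (through (hom y))) ∷ proj₂ (through (hom x)) ∷ [] ,
      VAll.map⁻ (member-vanishes (pencil-class T x))
      where open Pencil ≤-refl (Vec.map hom T)

    -- Otherwise `x`, `y` and the `d - 1` points of `T` would be `d + 1` distinct points of `P` on
    -- one hyperplane.
    not-in-common-class : ∀ {P S} {T : Vec (Point F d) j} {x y} → GeneralPosition F d P → Contains S P →
      VAll.All (_∈ S) T → VUnique.Unique T → All (_≢ x) S → All (_≢ y) S → x ≢ y →
      pencil-class T x ≡ pencil-class T y → P x ≡ true → P y ≢ true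
    not-in-common-class {P} {S} {T} {x} {y} gp S⊆P T⊆S uT x∉S y∉S x≢y eq Px Py
      with φ , φ≢𝟎 , zy ∷ zx ∷ [] , zT ← same-class⇒cohyperplanar T {x} {y} eq =
      gp f (λ {a} {b} → VUnique.lookup-injective unique a b) (λ i → VAll.lookup⁺ in-P i)
        (zeros-hyperplane φ≢𝟎 f (λ i → VAll.lookup⁺ {P = Zero φ} (zx ∷ zy ∷ zT) i))
      where
      f = lookup (x ∷ y ∷ T)
      in-P : VAll.All (λ z → P z ≡ true) (x ∷ y ∷ T)
      in-P = Px ∷ Py ∷ VAll.map (All.lookup S⊆P) T⊆S
      unique : VUnique.Unique (x ∷ y ∷ T)
      unique = (x≢y ∷ VAll.map (≢-sym ∘ All.lookup x∉S) T⊆S) ∷ VAll.map (≢-sym ∘ All.lookup y∉S) T⊆S ∷ uT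

    -- `count-by-prefix` fixes the first `j * t` elements `S`; for each `S` the graph count applies
    -- to the rest, with `q + 1` classes and `D = j * d`.
    count-general-position : ∀ t κ h → 0 < t → suc q * (j * d) ≤ suc κ * t → q ^ d * κ ^ h < suc κ ^ h →
      (L : List (Point F d → Bool)) → AllPairs Differ L → All (GeneralPosition F d) L →
      length L ≤ 2 ^ suc q * suc (q ^ d) ^ h * suc (q ^ d) ^ (j * t)
    count-general-position t κ h 0<t ND≤Kt small L diff gps = subst (λ m → length L ≤ M * suc m ^ (j * t)) (length-allVecs q d)
      (count-by-prefix {M = M} {Φ = GeneralPosition F d} (*-mono-≤ (m^n>0 2 (suc q)) (m^n>0 (suc (q ^ d)) h))
        bound (j * t) [] (allVecs q d)
        (+-identityʳ _) [] (allVecs-unique q d) (λ _ → []) (≤-reflexive (length-allVecs q d))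
        (AllPairs.map (λ (x , ne) → x , ∈-allVecs x , ne) diff) (All.map (λ gp → gp , []) gps))
      where
      M = 2 ^ suc q * suc (q ^ d) ^ h
      bound : ∀ S U {L} → length S ≡ j * t → Unique S → Unique U → (∀ {x} → x ∈ U → All (_≢ x) S) → length U ≤ q ^ d →
        AllPairs (DiffOn U) L → All (λ P → GeneralPosition F d P × Contains S P) L → length L ≤ M
      bound S U {[]}    len uS uU disj U≤ diff φs = z≤n
      -- A member is at hand here: the multiplicity bound rests on `S` lying in a set in general
      -- position.
      bound S U {P ∷ L} len uS uU disj U≤ diff φs@((gp , S⊆P) ∷ _) =
        -- The whole space has `q ^ d` points, which bounds the initial excess.
        count-stable h (q ^ d) U uU (≤-trans U≤ (m≤n+m (q ^ d) (suc q))) small diff (All.map stable φs)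
        where
        𝒯 = transversals t j S
        len𝒯 = length-transversals t j S len
        multiplicity : ∀ {x y} → x ≢ y → ∑ 𝒯 (λ T → ⟦ pencil-class T x Fin.≟ pencil-class T y ⟧) * t ≤ j * d * length 𝒯
        multiplicity {x} {y} x≢y = subst
          (λ m → ∑ 𝒯 (λ T → ⟦ pencil-class T x Fin.≟ pencil-class T y ⟧) * t ≤ j * d * m) (sym len𝒯)
          (few-cohyperplanar t gp j S (independent-pair x≢y) refl len uS S⊆P
            (λ T → pencil-class T x Fin.≟ pencil-class T y) (λ {T} → same-class⇒cohyperplanar T))
        open Supersaturation _≟ⱽ_ pencil-class 𝒯 t (j * d) κ
          (subst (0 <_) (sym len𝒯) (m^n>0 t {{>-nonZero 0<t}} j)) 0<t multiplicity ND≤Kt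
        open Containers _≟ⱽ_ adj? (suc q) κ shrink
        stable : ∀ {P} → GeneralPosition F d P × Contains S P → Stable U P
        stable (gp , S⊆P) x y x∈U y∈U x≢y xy with T , T∈ , eq ← find xy with T⊆S , uT ← transversal-unique t j uS T∈ =
          not-in-common-class gp S⊆P T⊆S uT (disj x∈U) (disj y∈U) x≢y eq

-- The numerical estimate

^-distribʳ-* : ∀ n a b → (a * b) ^ n ≡ a ^ n * b ^ n
^-distribʳ-* zero    a b = refl
^-distribʳ-* (suc n) a b = trans (cong (a * b *_) (^-distribʳ-* n a b)) ([m*n]*[o*p]≡[m*o]*[n*p] a b (a ^ n) (b ^ n))

-- Raising `n` by one raises the integer root by at most one.
floor-root : ∀ e .{{_ : NonZero e}} n → ∃[ r ] (r ^ e ≤ n × n < suc r ^ e)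
floor-root (suc e) zero = 0 , z≤n , m^n>0 1 (suc e)
floor-root e (suc n) with r , r^e≤n , n< ← floor-root e n with suc n <? suc r ^ e
... | yes 1+n< = r , m≤n⇒m≤1+n r^e≤n , 1+n<
... | no  1+n≮ = suc r , ≮⇒≥ 1+n≮ , ≤-<-trans n< (^-monoˡ-< e (n<1+n (suc r)))

1+n≤2^n : ∀ n → suc n ≤ 2 ^ n
1+n≤2^n zero    = ≤-refl
1+n≤2^n (suc n) = +-mono-≤ (m^n>0 2 n) (≤-trans (1+n≤2^n n) (≤-reflexive (sym (+-identityʳ (2 ^ n)))))

-- The first two terms of the binomial expansion.
bernoulli : ∀ x n → x ^ suc n + suc n * x ^ n ≤ suc x ^ suc n
bernoulli x zero    = ≤-reflexive (solve 1 (λ x → x :* con 1 :+ con 1 := (con 1 :+ x) :* con 1) refl x)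
  where open +-*-Solver
bernoulli x (suc n) = begin
  x * (x * p) + suc (suc n) * (x * p)                 ≤⟨ m≤m+n _ (suc n * p) ⟩
  x * (x * p) + suc (suc n) * (x * p) + suc n * p     ≡⟨ expand x n p ⟩
  suc x * (x * p + suc n * p)                         ≤⟨ *-monoʳ-≤ (suc x) (bernoulli x n) ⟩
  suc x ^ suc (suc n)                                 ∎
  where
  open ≤-Reasoning
  open +-*-Solver
  p = x ^ n
  expand = solve 3 (λ x n p → x :* (x :* p) :+ (con 2 :+ n) :* (x :* p) :+ (con 1 :+ n) :* p :=
    (con 1 :+ x) :* (x :* p :+ (con 1 :+ n) :* p)) refl

-- With `K = κ + 1`, this is `(1 + 1/κ) ^ K ≥ 2`: `K` shrinkings at least halve the excess.
2κ^K≤K^K : ∀ κ → 2 * κ ^ suc κ ≤ suc κ ^ suc κ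
2κ^K≤K^K κ = ≤-trans (+-monoʳ-≤ (κ ^ suc κ) (≤-trans (≤-reflexive (+-identityʳ _)) (m≤n+m (κ ^ suc κ) (κ ^ κ)))) (bernoulli κ κ)

-- The excess is halved `E` times, which brings any `x < 2 ^ E` below 1.
decay : ∀ κ .{{_ : NonZero κ}} E {x} → suc x ≤ 2 ^ E → x * κ ^ (suc κ * E) < suc κ ^ (suc κ * E)
decay κ E {x} x<2^E = begin-strict
  x * κ ^ (suc κ * E)          <⟨ *-monoˡ-< (κ ^ (suc κ * E)) {{m^n≢0 κ (suc κ * E)}} x<2^E ⟩
  2 ^ E * κ ^ (suc κ * E)      ≡⟨ cong (2 ^ E *_) (^-*-assoc κ (suc κ) E) ⟨
  2 ^ E * (κ ^ suc κ) ^ E      ≡⟨ ^-distribʳ-* E 2 (κ ^ suc κ) ⟨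
  (2 * κ ^ suc κ) ^ E          ≤⟨ ^-monoˡ-≤ E (2κ^K≤K^K κ) ⟩
  (suc κ ^ suc κ) ^ E          ≡⟨ ^-*-assoc (suc κ) (suc κ) E ⟩
  suc κ ^ (suc κ * E)          ∎
  where open ≤-Reasoning

-- Every term is at most its coefficient times `r ^ 7`; `C` is the sum of these coefficients, and
-- `C ≤ r` absorbs it.
exponent-bound : ∀ a b j d → ∃[ R ] (∀ r → R ≤ r → 0 < r ×
  1 + r * a * d * (suc (b * (j * d) * r ^ 5) * (r * a * d)) + r * a * d * (j * r ^ 5) ≤ r ^ 8)
exponent-bound a b j d = C , λ r C≤r → ≤-trans (s≤s z≤n) C≤r , bound r (≤-trans (s≤s z≤n) C≤r) C≤r
  where
  open ≤-Reasoning
  open +-*-Solver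
  C = 1 + (a * d) * (a * d) * (1 + b * (j * d)) + a * d * j
  bound : ∀ r → 0 < r → C ≤ r →
    1 + r * a * d * (suc (b * (j * d) * r ^ 5) * (r * a * d)) + r * a * d * (j * r ^ 5) ≤ r ^ 8
  bound r 0<r C≤r = begin
    1 + r * a * d * (suc (κ * p) * (r * a * d)) + r * a * d * (j * p)
      ≤⟨ +-mono-≤ (+-mono-≤ 1≤rrp (*-monoʳ-≤ (r * a * d) (*-monoˡ-≤ (r * a * d) (+-monoˡ-≤ (κ * p) 1≤p)))) ≤-refl ⟩
    r * (r * p) + r * a * d * ((p + κ * p) * (r * a * d)) + r * a * d * (j * p)
      ≡⟨ cong₂ _+_ (solve 5 (λ r a d p k → r :* (r :* p) :+ r :* a :* d :* ((p :+ k :* p) :* (r :* a :* d)) :=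
          (con 1 :+ (a :* d) :* (a :* d) :* (con 1 :+ k)) :* (r :* (r :* p))) refl r a d p κ)
        (solve 5 (λ r a d j p → r :* a :* d :* (j :* p) := a :* d :* j :* (r :* p)) refl r a d j p) ⟩
    (1 + (a * d) * (a * d) * (1 + κ)) * (r * (r * p)) + a * d * j * (r * p)
      ≤⟨ +-monoʳ-≤ _ (*-monoʳ-≤ (a * d * j) (m≤n*m (r * p) r)) ⟩
    (1 + (a * d) * (a * d) * (1 + κ)) * (r * (r * p)) + a * d * j * (r * (r * p))
      ≡⟨ *-distribʳ-+ (r * (r * p)) (1 + (a * d) * (a * d) * (1 + κ)) (a * d * j) ⟨
    C * (r * (r * p))
      ≤⟨ *-monoˡ-≤ (r * (r * p)) C≤r ⟩
    r * (r * (r * p)) ∎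
    where
    instance
      r≢0 : NonZero r
      r≢0 = >-nonZero 0<r
    p = r ^ 5
    κ = b * (j * d)
    1≤p : 1 ≤ p
    1≤p = m^n>0 r 5
    1≤rrp : 1 ≤ r * (r * p)
    1≤rrp = m^n>0 r 7

-- With `d = 2 + e` this is `8/10 ≤ 2d/(2d + 1) + a/b` cleared of denominators; at `d = 2` the first
-- fraction on the right already equals `8/10`.
8B≤10A : ∀ e a b → 8 * ((2 * (2 + e) + 1) * b) ≤ (5 + 5) * (2 * (2 + e) * b + a * (2 * (2 + e) + 1))
8B≤10A e a b = ≤-trans (m≤m+n _ (4 * (e * b) + 10 * (a * (2 * (2 + e) + 1))))
  (≤-reflexive (solve 3 (λ e a b →
    con 8 :* ((con 2 :* (con 2 :+ e) :+ con 1) :* b)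
      :+ (con 4 :* (e :* b) :+ con 10 :* (a :* (con 2 :* (con 2 :+ e) :+ con 1)))
        := (con 5 :+ con 5) :* (con 2 :* (con 2 :+ e) :* b :+ a :* (con 2 :* (con 2 :+ e) :+ con 1))) refl e a b))
  where open +-*-Solver

≤-floor-root : ∀ u {R r q} → R ^ u ≤ q → q < suc r ^ u → R ≤ r
≤-floor-root u R^u≤q q< = ≮⇒≥ λ r<R → <⇒≱ q< (≤-trans (^-monoˡ-≤ u r<R) R^u≤q)

2^-cancel-≤ : ∀ {x y} → 2 ^ x ≤ 2 ^ y → x ≤ y
2^-cancel-≤ le = ≮⇒≥ λ y<x → <⇒≱ (^-monoʳ-< 2 (s≤s (s≤s z≤n)) y<x) le

[1+r]^u≤2^ru : ∀ u r → suc r ^ u ≤ 2 ^ (r * u)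
[1+r]^u≤2^ru u r = ≤-trans (^-monoˡ-≤ u (1+n≤2^n r)) (≤-reflexive (^-*-assoc 2 r u))

[1+r]^2c≤ : ∀ c {r} → 0 < r → suc r ^ (c + c) ≤ 2 ^ (c + c) * (r ^ c * r ^ c)
[1+r]^2c≤ c {r} 0<r = begin
  suc r ^ (c + c)                  ≤⟨ ^-monoˡ-≤ (c + c) (+-mono-≤ 0<r (≤-reflexive (sym (+-identityʳ r)))) ⟩
  (2 * r) ^ (c + c)                ≡⟨ ^-distribʳ-* (c + c) 2 r ⟩
  2 ^ (c + c) * r ^ (c + c)        ≡⟨ cong (2 ^ (c + c) *_) (^-distribˡ-+-* r c c) ⟩
  2 ^ (c + c) * (r ^ c * r ^ c)    ∎
  where open ≤-Reasoning

-- Since `r` is at most `q ^ (1/u)`, `m / k` is at most `q ^ (w/u)`, and `w/u ≤ A/B`.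
power-bound : ∀ u w A B {q r m k} .{{_ : NonZero r}} → w * B ≤ u * A → r ^ u ≤ q → m ≤ k * r ^ w → m ^ B ≤ k ^ B * q ^ A
power-bound u w A B {q} {r} {m} {k} wB≤uA r^u≤q m≤ = begin
  m ^ B                  ≤⟨ ^-monoˡ-≤ B m≤ ⟩
  (k * r ^ w) ^ B        ≡⟨ ^-distribʳ-* B k (r ^ w) ⟩
  k ^ B * (r ^ w) ^ B    ≡⟨ cong (k ^ B *_) (^-*-assoc r w B) ⟩
  k ^ B * r ^ (w * B)    ≤⟨ *-monoʳ-≤ (k ^ B) (^-monoʳ-≤ r wB≤uA) ⟩
  k ^ B * r ^ (u * A)    ≡⟨ cong (k ^ B *_) (^-*-assoc r u A) ⟨
  k ^ B * (r ^ u) ^ A    ≤⟨ *-monoʳ-≤ (k ^ B) (^-monoˡ-≤ A r^u≤q) ⟩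
  k ^ B * q ^ A          ∎
  where open ≤-Reasoning

-- The second hypothesis says that `m / k` is at most `log₂ N - q`, and the first bounds that
-- difference by `x`.
log-excess-bound : ∀ x q k m {N} → N ≤ 2 ^ (q + x) → 2 ^ (q * k + m) ≤ N ^ k → m ≤ k * x
log-excess-bound x q k m {N} N≤ 2^≤ = +-cancelˡ-≤ (q * k) m (k * x) (2^-cancel-≤ (begin
  2 ^ (q * k + m)      ≤⟨ 2^≤ ⟩
  N ^ k                ≤⟨ ^-monoˡ-≤ k N≤ ⟩
  (2 ^ (q + x)) ^ k    ≡⟨ ^-*-assoc 2 (q + x) k ⟩
  2 ^ ((q + x) * k)    ≡⟨ cong (2 ^_) (trans (*-distribʳ-+ k q x) (cong (q * k +_) (*-comm x k))) ⟩
  2 ^ (q * k + k * x)  ∎))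
  where open ≤-Reasoning

-- `α` and `β` are constants independent of `q`, with `log₂ (q + 1) ≤ α r` and `q + 1 ≤ β r ^ 10`.
module _ (e α β : ℕ) .{{_ : NonZero β}} where
  private
    j d : ℕ
    j = suc e
    d = suc j
    threshold = exponent-bound α β j d

  R₀ : ℕ
  R₀ = proj₁ threshold

  R₀≤⇒0< : ∀ {r} → R₀ ≤ r → 0 < r
  R₀≤⇒0< {r} R₀≤r = proj₁ (proj₂ threshold r R₀≤r)

  -- With r ≈ q^(1/10) the blocks have size t = r⁵ ≈ √q, and then κ ≈ √q as well. A logarithm costs at most
  -- a factor r, so the total exponent is O(r⁷) ≤ r⁸ ≤ q^(4/5), and 4/5 ≤ 2d/(2d+1).
  count-general-position-root : ∀ {q r} (F : FiniteField q) → R₀ ≤ r → suc q ≤ 2 ^ (r * α) → suc q ≤ β * (r ^ 5 * r ^ 5) →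
    (L : List (Point F d → Bool)) → AllPairs Differ L → All (GeneralPosition F d) L → length L ≤ 2 ^ (q + r ^ 8)
  count-general-position-root {q} {r} F R₀≤r q<2^ q<βt² L diff gps = begin
    length L
      ≤⟨ Geometry.count-general-position F t κ h (m^n>0 r 5) pencil≤ (decay κ E points≤) L diff gps ⟩
    2 ^ suc q * suc (q ^ d) ^ h * suc (q ^ d) ^ (j * t)
      ≤⟨ *-mono-≤ (*-monoʳ-≤ (2 ^ suc q) (^-monoˡ-≤ h points≤)) (^-monoˡ-≤ (j * t) points≤) ⟩
    2 ^ suc q * (2 ^ E) ^ h * (2 ^ E) ^ (j * t)
      ≡⟨ cong₂ (λ x y → 2 ^ suc q * x * y) (^-*-assoc 2 E h) (^-*-assoc 2 E (j * t)) ⟩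
    2 ^ suc q * 2 ^ (E * h) * 2 ^ (E * (j * t))
      ≡⟨ cong (_* 2 ^ (E * (j * t))) (^-distribˡ-+-* 2 (suc q) (E * h)) ⟨
    2 ^ (suc q + E * h) * 2 ^ (E * (j * t))
      ≡⟨ ^-distribˡ-+-* 2 (suc q + E * h) (E * (j * t)) ⟨
    2 ^ (suc q + E * h + E * (j * t))
      ≡⟨ cong (2 ^_) (regroup q (E * h) (E * (j * t))) ⟩
    2 ^ (q + (1 + E * h + E * (j * t)))
      ≤⟨ ^-monoʳ-≤ 2 (+-monoʳ-≤ q (proj₂ (proj₂ threshold r R₀≤r))) ⟩
    2 ^ (q + r ^ 8) ∎
    where
    open ≤-Reasoning
    open +-*-Solver
    t = r ^ 5
    -- `κ` is chosen for `pencil≤`, `E` bounds the logarithm of the number of points, and `h` is the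
    -- number of shrinkings in `decay`.
    κ = β * (j * d) * t
    E = r * α * d
    h = suc κ * E
    instance
      r≢0 : NonZero r
      r≢0 = >-nonZero (R₀≤⇒0< R₀≤r)
      κ≢0 : NonZero κ
      κ≢0 = m*n≢0 (β * (j * d)) t {{m*n≢0 β (j * d)}} {{m^n≢0 r 5}}
    points≤ : suc (q ^ d) ≤ 2 ^ E
    points≤ = begin
      suc (q ^ d)         ≤⟨ ^-monoˡ-< d (n<1+n q) ⟩
      suc q ^ d           ≤⟨ ^-monoˡ-≤ d q<2^ ⟩
      (2 ^ (r * α)) ^ d   ≡⟨ ^-*-assoc 2 (r * α) d ⟩
      2 ^ E               ∎
    pencil≤ : suc q * (j * d) ≤ suc κ * t
    pencil≤ = begin
      suc q * (j * d)        ≤⟨ *-monoˡ-≤ (j * d) q<βt² ⟩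
      β * (t * t) * (j * d)  ≡⟨ solve 3 (λ b t m → b :* (t :* t) :* m := b :* m :* t :* t) refl β t (j * d) ⟩
      κ * t                  ≤⟨ *-monoˡ-≤ t (n≤1+n κ) ⟩
      suc κ * t              ∎
    regroup : ∀ q x y → suc q + x + y ≡ q + (1 + x + y)
    regroup = solve 3 (λ q x y → con 1 :+ q :+ x :+ y := q :+ (con 1 :+ x :+ y)) refl

-- Real exponents are avoided: `a / b` is an arbitrary positive bound for the `o(1)` term, and
-- `m / k` runs through the rationals up to `log₂ (length L) - q`. The conclusion is
-- `m / k ≤ q ^ (2d/(2d + 1) + a/b)`, raised to the power `(2d + 1) b`.
theorem1p3 : (d : ℕ) → 2 ≤ d → (a b : ℕ) → 1 ≤ a → 1 ≤ b →
    ∃[ Q ] ((q : ℕ) → Q ≤ q → IsPrimePower q → (F : FiniteField q) →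
    (L : List (Point F d → Bool)) → AllPairs Differ L →
    All (GeneralPosition F d) L →
    (m k : ℕ) → 1 ≤ k → 2 ^ (q * k + m) ≤ length L ^ k →
    m ^ ((2 * d + 1) * b) ≤ k ^ ((2 * d + 1) * b) * q ^ (2 * d * b + a * (2 * d + 1)))
theorem1p3 (suc (suc e)) (s≤s (s≤s _)) a b _ _ =
  -- This threshold makes the integer tenth root `r` of `q` at least `R`.
  R ^ (5 + 5) , λ q R^10≤q _ F L diff gps m k _ 2^≤ →
    let r , r^10≤q , q< = floor-root (5 + 5) q
        R≤r = ≤-floor-root (5 + 5) {R} R^10≤q q<
        0<r = R₀≤⇒0< e (5 + 5) (2 ^ (5 + 5)) R≤r
        -- From `q + 1 ≤ (r + 1) ^ 10` come `α = 10`, by `r + 1 ≤ 2 ^ r`, and `β = 2 ^ 10`, by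
        -- `r + 1 ≤ 2 r`.
        N≤ = count-general-position-root e (5 + 5) (2 ^ (5 + 5)) F R≤r
               (≤-trans q< ([1+r]^u≤2^ru (5 + 5) r)) (≤-trans q< ([1+r]^2c≤ 5 0<r)) L diff gps
    in power-bound (5 + 5) 8 (2 * (2 + e) * b + a * (2 * (2 + e) + 1)) ((2 * (2 + e) + 1) * b)
         {q} {r} {m} {k} {{>-nonZero 0<r}} (8B≤10A e a b) r^10≤q (log-excess-bound (r ^ 8) q k m N≤ 2^≤)
  where
  R = R₀ e (5 + 5) (2 ^ (5 + 5))
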